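{- For all integers $k\ge 0$ and $n\ge k+2$, $$\mathrm{av}_n^k(1324,2413)=\mathrm{av}_n^k(1324)=\sum_{i=0}^k p(i)p(k-i),$$ where $p(i)$ is the number of integer partitions of $i$. In particular, $C_{1324,2413}(x)=P(x)^2$, where $P(x)=\sum_{i\ge 0}p(i)x^i$.
   Context: $\mathrm{av}_n^k(B)$ is the number of permutations in $S_n$ with exactly $k$ inversions (pairs $i<j$ with $\pi_i>\pi_j$) that avoid every pattern in $B$; a permutation avoids a pattern $q$ if it has no subsequence order-isomorphic to $q$. If for every $k\ge0$ there are constants $m_k,c_k(B)$ with $\mathrm{av}_n^k(B)=c_k(B)$ for all $n\ge m_k$, then $(c_k(B))_{k\ge0}$ is the limit sequence of $B$ and $C_B(x)=\sum_{k\ge 0}c_k(B)x^k$ is its limit generating function. -}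

module Defs where

open import Data.Fin.Base using (Fin; zero; suc; _<_; _>_; finToFun; funToFin; punchIn)
open import Data.Fin.Patterns using (0F; 1F; 2F; 3F)
open import Data.Fin.Permutation
  using (Permutation; Permutation′; permutation; _⟨$⟩ʳ_; id; insert; insert-remove; insert-punchIn; remove)
  renaming (_≈_ to _≈ₚ_)
open import Data.Fin.Properties
  using (_≟_; _<?_; any?; all?; finToFun-funToFin; punchIn-injective)
open import Data.List.Base
  using (List; []; _∷_; length; filter; concatMap; applyUpTo; allFin; cartesianProduct; cartesianProductWith)
open import Data.List.Membership.Propositional using (_∈_; find)
open import Data.List.Membership.Propositional.Properties using (∈-allFin; ∈-concatMap⁺; ∈-concatMap⁻)
open import Data.List.Membership.Setoid.Properties using (∈-resp-≈)
open import Data.List.Relation.Unary.All as All using (All; []; _∷_)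
import Data.List.Relation.Unary.All.Properties as All
open import Data.List.Relation.Unary.AllPairs using ([]; _∷_)
open import Data.List.Relation.Unary.Any as Any using (here; there)
import Data.List.Relation.Unary.Any.Properties as Any
import Data.List.Relation.Unary.Enumerates.Setoid as Enumerates
open import Data.List.Relation.Unary.Linked using (Linked; linked?)
import Data.List.Relation.Unary.Unique.Setoid as SetoidUnique
import Data.List.Relation.Unary.Unique.Setoid.Properties as SetoidUnique
open import Data.List.Relation.Unary.Unique.Propositional using (Unique)
import Data.List.Relation.Unary.Unique.Propositional.Properties as Unique
open import Data.Nat.Base as ℕ using (ℕ; zero; suc; _*_; _∸_; _≥_; _⊔_)
open import Data.Nat.ListAction using (sum)
import Data.Nat.Properties as ℕ
open import Data.Product.Base using (∃; _×_; _,_)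
open import Data.Vec.Base using (Vec; []; _∷_; lookup)
open import Function.Base using (_∘_)
open import Function.Bundles using (_⇔_; mk⇔; Equivalence)
open import Level using (0ℓ)
open import Relation.Binary.Bundles using (Setoid)
open import Relation.Binary.PropositionalEquality
  using (_≡_; _≗_; refl; sym; trans; cong; subst₂; setoid)
open import Relation.Nullary.Negation using (¬_)
open import Relation.Nullary.Decidable using (Dec; ¬?; map′; True; toWitness; _×-dec_; _→-dec_)
open import Relation.Unary using (Decidable)

------------------------------------------------------------------------
-- The symmetric group as a list

permutationSetoid : ℕ → Setoid 0ℓ 0ℓ
permutationSetoid n = record
  { Carrier       = Permutation′ n
  ; _≈_           = _≈ₚ_
  ; isEquivalence = record
    { refl  = λ _ → refl
    ; sym   = λ p i → sym (p i)
    ; trans = λ p q i → trans (p i) (q i)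
    }
  }

-- A permutation of suc n is determined by the image j of zero and by the
-- permutation of n obtained by deleting that entry and standardising.
permutations : ∀ n → List (Permutation′ n)
permutations zero    = id ∷ []
permutations (suc n) = cartesianProductWith (insert zero) (allFin (suc n)) (permutations n)

insert-cong : ∀ {n} {j l : Fin (suc n)} {π ρ : Permutation′ n} →
              j ≡ l → π ≈ₚ ρ → insert zero j π ≈ₚ insert zero l ρ
insert-cong refl π≈ρ zero    = refl
insert-cong refl π≈ρ (suc i) = cong (punchIn _) (π≈ρ i)

insert-injective : ∀ {n} {j l : Fin (suc n)} {π ρ : Permutation′ n} →
                   insert zero j π ≈ₚ insert zero l ρ → j ≡ l × π ≈ₚ ρ
insert-injective {j = j} {π = π} {ρ = ρ} eq with eq zero
... | refl = refl , λ i → punchIn-injective j (π ⟨$⟩ʳ i) (ρ ⟨$⟩ʳ i) (eq (suc i))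

permutations-complete : ∀ n → Enumerates.IsEnumeration (permutationSetoid n) (permutations n)
permutations-complete zero    π = here λ ()
permutations-complete (suc n) π =
  ∈-resp-≈ (permutationSetoid (suc n))
    {x = insert zero (π ⟨$⟩ʳ zero) (remove zero π)} {y = π} (insert-remove zero π)
    (Any.cartesianProductWith⁺ (insert zero) (λ {_} {ρ} → insert-cong {π = remove zero π} {ρ})
      (∈-allFin (π ⟨$⟩ʳ zero)) (permutations-complete n (remove zero π)))

permutations-unique : ∀ n → SetoidUnique.Unique (permutationSetoid n) (permutations n)
permutations-unique zero    = [] ∷ []
permutations-unique (suc n) =
  SetoidUnique.cartesianProductWith⁺ (setoid _) (permutationSetoid n) (permutationSetoid (suc n))
    (insert zero) (λ {_} {_} {π} {ρ} → insert-injective {π = π} {ρ}) (Unique.allFin⁺ (suc n)) (permutations-unique n)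

------------------------------------------------------------------------
-- Inversions

IsInversion : ∀ {n} → Permutation′ n → Fin n × Fin n → Set
IsInversion π (i , j) = i < j × π ⟨$⟩ʳ i > π ⟨$⟩ʳ j

isInversion? : ∀ {n} (π : Permutation′ n) → Decidable (IsInversion π)
isInversion? π (i , j) = i <? j ×-dec (π ⟨$⟩ʳ j) <? (π ⟨$⟩ʳ i)

inv : ∀ {n} → Permutation′ n → ℕ
inv {n} π = length (filter (isInversion? π) (cartesianProduct (allFin n) (allFin n)))

------------------------------------------------------------------------
-- Pattern avoidance

-- f lists the positions of a subsequence of π order-isomorphic to q.
IsOccurrence : ∀ {m n} → Permutation′ m → Permutation′ n → (Fin m → Fin n) → Set
IsOccurrence q π f =
    (∀ i j → i < j → f i < f j)
  × (∀ i j → q ⟨$⟩ʳ i < q ⟨$⟩ʳ j ⇔ π ⟨$⟩ʳ f i < π ⟨$⟩ʳ f j)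

Contains : ∀ {m n} → Permutation′ n → Permutation′ m → Set
Contains π q = ∃ (IsOccurrence q π)

Pattern : Set
Pattern = ∃ Permutation′

Avoids : ∀ {n} → Permutation′ n → Pattern → Set
Avoids π (_ , q) = ¬ Contains π q

infix 2 _⇔-dec_

_⇔-dec_ : {A B : Set} → Dec A → Dec B → Dec (A ⇔ B)
a? ⇔-dec b? =
  map′ (λ (to , from) → mk⇔ to from) (λ e → Equivalence.to e , Equivalence.from e)
    ((a? →-dec b?) ×-dec (b? →-dec a?))

isOccurrence? : ∀ {m n} (q : Permutation′ m) (π : Permutation′ n) → Decidable (IsOccurrence q π)
isOccurrence? q π f =
        all? (λ i → all? λ j → i <? j →-dec f i <? f j)
  ×-dec all? (λ i → all? λ j → (q ⟨$⟩ʳ i) <? (q ⟨$⟩ʳ j) ⇔-dec (π ⟨$⟩ʳ f i) <? (π ⟨$⟩ʳ f j))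

isOccurrence-resp-≗ : ∀ {m n} (q : Permutation′ m) (π : Permutation′ n) {f g : Fin m → Fin n} →
                      f ≗ g → IsOccurrence q π f → IsOccurrence q π g
isOccurrence-resp-≗ q π f≗g (incr , iso) =
    (λ i j i<j → subst₂ _<_ (f≗g i) (f≗g j) (incr i j i<j))
  , (λ i j → subst₂ (λ k l → q ⟨$⟩ʳ i < q ⟨$⟩ʳ j ⇔ π ⟨$⟩ʳ k < π ⟨$⟩ʳ l) (f≗g i) (f≗g j) (iso i j))

contains? : ∀ {m n} (π : Permutation′ n) (q : Permutation′ m) → Dec (Contains π q)
contains? π q =
  map′ (λ (c , occ) → finToFun c , occ)
       (λ (f , occ) → funToFin f , isOccurrence-resp-≗ q π (sym ∘ finToFun-funToFin f) occ)
       (any? (isOccurrence? q π ∘ finToFun))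

avoids? : ∀ {n} (π : Permutation′ n) → Decidable (Avoids π)
avoids? π (_ , q) = ¬? (contains? π q)

AvoidsWithInversions : ∀ {n} → ℕ → List Pattern → Permutation′ n → Set
AvoidsWithInversions k B π = inv π ≡ k × All (Avoids π) B

avoidsWithInversions? : ∀ {n} k B → Decidable (AvoidsWithInversions {n} k B)
avoidsWithInversions? k B π = inv π ℕ.≟ k ×-dec All.all? (avoids? π) B

av : (n k : ℕ) → List Pattern → ℕ
av n k B = length (filter (avoidsWithInversions? k B) (permutations n))

-- The permutation with the given one-line notation, with entries counted from
-- zero; the second argument is the one-line notation of its inverse.
oneLine : ∀ {n} (v w : Vec (Fin n) n) →
          {True (all? λ i → lookup v (lookup w i) ≟ i)} →
          {True (all? λ i → lookup w (lookup v i) ≟ i)} →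
          Permutation′ n
oneLine v w {vw} {wv} = permutation (lookup v) (lookup w) (toWitness vw) (toWitness wv)

pattern1324 pattern2413 : Pattern
pattern1324 = 4 , oneLine (0F ∷ 2F ∷ 1F ∷ 3F ∷ []) (0F ∷ 2F ∷ 1F ∷ 3F ∷ [])
pattern2413 = 4 , oneLine (1F ∷ 3F ∷ 0F ∷ 2F ∷ []) (2F ∷ 0F ∷ 3F ∷ 1F ∷ [])

------------------------------------------------------------------------
-- Integer partitions

IsPartition : ℕ → List ℕ → Set
IsPartition n xs = Linked _≥_ xs × All (ℕ._> 0) xs × sum xs ≡ n

isPartition? : ∀ n → Decidable (IsPartition n)
isPartition? n xs = linked? ℕ._≥?_ xs ×-dec All.all? (ℕ._>? 0) xs ×-dec sum xs ℕ.≟ n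

-- Every composition of suc n arises in exactly one way from a composition of n,
-- either by prepending a part 1 or by increasing the first part.
grow : List ℕ → List (List ℕ)
grow []       = (1 ∷ []) ∷ []
grow (x ∷ xs) = (1 ∷ x ∷ xs) ∷ (suc x ∷ xs) ∷ []

compositions : ℕ → List (List ℕ)
compositions zero    = [] ∷ []
compositions (suc n) = concatMap grow (compositions n)

p : ℕ → ℕ
p n = length (filter (isPartition? n) (compositions n))

compositions-complete : ∀ n xs → All (ℕ._> 0) xs → sum xs ≡ n → xs ∈ compositions n
compositions-complete zero    []                 _          _  = here refl
compositions-complete zero    (suc x ∷ xs)       _          ()
compositions-complete (suc n) []                 _          ()
compositions-complete n       (zero ∷ xs)        (() ∷ _)   _
compositions-complete (suc n) (suc zero ∷ [])    _          eq =
  ∈-concatMap⁺ grow (Any.map (λ { refl → here refl })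
    (compositions-complete n [] [] (ℕ.suc-injective eq)))
compositions-complete (suc n) (suc zero ∷ y ∷ xs) (_ ∷ pos) eq =
  ∈-concatMap⁺ grow (Any.map (λ { refl → here refl })
    (compositions-complete n (y ∷ xs) pos (ℕ.suc-injective eq)))
compositions-complete (suc n) (suc (suc x) ∷ xs) (_ ∷ pos) eq =
  ∈-concatMap⁺ grow (Any.map (λ { refl → there (here refl) })
    (compositions-complete n (suc x ∷ xs) (ℕ.z<s ∷ pos) (ℕ.suc-injective eq)))

compositions-positive : ∀ n → All (All (ℕ._> 0)) (compositions n)
compositions-positive zero    = [] ∷ []
compositions-positive (suc n) = All.concat⁺ (All.map⁺ (All.map grow-positive (compositions-positive n)))
  where
  grow-positive : ∀ {xs} → All (ℕ._> 0) xs → All (All (ℕ._> 0)) (grow xs)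
  grow-positive []          = (ℕ.z<s ∷ []) ∷ []
  grow-positive (px ∷ pxs) = (ℕ.z<s ∷ px ∷ pxs) ∷ (ℕ.z<s ∷ pxs) ∷ []

shrink : List ℕ → List ℕ
shrink []                 = []
shrink (zero ∷ xs)        = xs
shrink (suc zero ∷ xs)    = xs
shrink (suc (suc x) ∷ xs) = suc x ∷ xs

shrink-grow : ∀ {xs ys} → All (ℕ._> 0) xs → ys ∈ grow xs → shrink ys ≡ xs
shrink-grow {[]}         _        (here refl)         = refl
shrink-grow {x ∷ xs}     _        (here refl)         = refl
shrink-grow {suc x ∷ xs} _        (there (here refl)) = refl
shrink-grow {zero ∷ xs}  (() ∷ _) (there _)

compositions-unique : ∀ n → Unique (compositions n)
compositions-unique zero    = [] ∷ []
compositions-unique (suc n) = concatMap-unique (compositions-positive n) (compositions-unique n)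
  where
  grow-unique : ∀ {xs} → All (ℕ._> 0) xs → Unique (grow xs)
  grow-unique []      = [] ∷ []
  grow-unique (_ ∷ _) = ((λ ()) ∷ []) ∷ [] ∷ []

  concatMap-unique : ∀ {xss} → All (All (ℕ._> 0)) xss → Unique xss → Unique (concatMap grow xss)
  concatMap-unique []           _               = []
  concatMap-unique (pos ∷ poss) (xs∉xss ∷ xss!) =
    Unique.++⁺ (grow-unique pos) (concatMap-unique poss xss!) λ (y∈ , y∈′) →
      let (zs , zs∈xss , y∈″) = find (∈-concatMap⁻ grow y∈′)
      in All.lookup xs∉xss zs∈xss
           (trans (sym (shrink-grow pos y∈)) (shrink-grow (All.lookup poss zs∈xss) y∈″))

------------------------------------------------------------------------
-- Formal power series, given by their coefficients

PowerSeries : Set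
PowerSeries = ℕ → ℕ

∑[0≤i≤_] : ℕ → (ℕ → ℕ) → ℕ
∑[0≤i≤ k ] f = sum (applyUpTo f (suc k))

_⊛_ : PowerSeries → PowerSeries → PowerSeries
(f ⊛ g) k = ∑[0≤i≤ k ] λ i → f i * g (k ∸ i)

_² : PowerSeries → PowerSeries
f ² = f ⊛ f

P : PowerSeries
P = p

------------------------------------------------------------------------
-- Limit sequences

IsLimitSequence : List Pattern → (ℕ → ℕ) → Set
IsLimitSequence B c = ∀ k → ∃ λ m → ∀ n → n ≥ m → av n k B ≡ c k

LimitSequence : List Pattern → Set
LimitSequence B = ∃ (IsLimitSequence B)

limitGF : ∀ {B} → LimitSequence B → PowerSeries
limitGF (c , _) = c

limitGF-unique : ∀ {B} (L M : LimitSequence B) → limitGF L ≗ limitGF M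
limitGF-unique (c , c-lim) (d , d-lim) k =
  let (a , c-eq) = c-lim k
      (b , d-eq) = d-lim k
  in trans (sym (c-eq (a ⊔ b) (ℕ.m≤m⊔n a b))) (d-eq (a ⊔ b) (ℕ.m≤n⊔m a b))

{-# OPTIONS --safe #-}

-- Write a permutation π of n letters as its first entry j followed by the
-- standardised rest ρ, so that inv π = j + inv ρ. If inv π ≤ n − 2 then π is a
-- direct sum of two nonempty permutations: peeling off first entries, some cut
-- of the rest lies above each of them. This has two consequences for such π.
-- A 2413 lies inside one summand, where its 132 or 213 extends to a 1324 by an
-- entry of the other; and if j > 0, then π avoids 1324 exactly when ρ does and
-- the first entry of ρ is at most j, since an ascent from j makes a 132 within
-- the first summand. Hence the nonzero first entries peeled off from a
-- 1324-avoider form a partition λ. When the first entry 0 is reached, the rest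
-- avoids 213, and its reverse-complement avoids 132. Peeling off the first
-- entries of a 132-avoider in the same way ends in the identity and gives a
-- second partition μ, with |λ| + |μ| the number of inversions. The two peelings
-- are one recursion with different initial values, which the partitions with
-- bounded parts, convolved with the initial values, satisfy as well.
module Submission where

open import Defs
import Algebra.Properties.CommutativeSemigroup
open import Data.Fin.Base as Fin using (Fin; zero; suc; toℕ; fromℕ<; punchIn; opposite)
open import Data.Fin.Patterns using (0F; 1F; 2F; 3F)
open import Data.Fin.Permutation
  using (Permutation′; _⟨$⟩ʳ_; _⟨$⟩ˡ_; inverseˡ; inverseʳ; id; insert; remove; reverse; _∘ₚ_;
         insert-remove)
  renaming (_≈_ to _≈ₚ_)
import Data.Fin.Properties as Fin
open import Data.List.Base
  using (List; _∷_; []; length; filter; lookup; allFin; cartesianProduct)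
open import Data.List.Membership.Propositional.Properties using (∈-allFin; ∈-cartesianProduct⁺; ∈-lookup)
open import Data.List.Membership.Propositional using () renaming (_∈_ to _∈ₚ_)
import Data.List.Membership.Setoid as SetoidMembership
import Data.List.Membership.Setoid.Properties as SetoidMembershipₚ
open import Data.List.Properties using (filter-all; filter-none; filter-≐; length-tabulate)
open import Data.List.Relation.Unary.All as All using (All; []; _∷_)
import Data.List.Relation.Unary.All.Properties as All
open import Data.List.Relation.Unary.AllPairs using ([]; _∷_)
import Data.List.Relation.Unary.Any as Any
import Data.List.Relation.Unary.Any.Properties as Any
open import Data.List.Relation.Unary.Linked as Linked using (Linked; []; [-]; _∷_; linked?)
import Data.List.Relation.Unary.Unique.Setoid as SetoidUnique
import Data.List.Relation.Unary.Unique.Setoid.Properties as SetoidUniqueₚ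
import Data.List.Relation.Unary.Unique.Propositional.Properties as Unique
open import Data.Nat.Base
  using (ℕ; zero; suc; _+_; _*_; _∸_; _≤_; _<_; _≥_; _>_; z≤n; s≤s; s<s; s<s⁻¹; s≤s⁻¹; z<s)
open import Data.Nat.ListAction using (sum)
import Data.Nat.Properties as ℕ
open import Data.Product.Base using (_×_; ∃; _,_; proj₁; proj₂)
open import Data.Sum.Base using (inj₁; inj₂)
open import Data.Unit.Base using (⊤; tt)
import Data.Vec.Base as Vec
open Vec using (Vec; []; _∷_)
open import Data.Vec.Properties using (lookup∘tabulate)
open import Data.Vec.Relation.Unary.Linked using ([]; [-]; _∷_) renaming (Linked to VecLinked)
open import Data.Vec.Relation.Unary.Linked.Properties using (lookup⁺)
open import Function.Base using (_∘_; const)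
open import Function.Bundles using (_⇔_; mk⇔; Equivalence; Injection)
open import Function.Properties.Inverse using (↔⇒↣)
open import Level using (0ℓ)
open import Relation.Binary.Bundles using (Setoid)
open import Relation.Binary.Definitions using (_Respects_; tri<; tri≈; tri>)
open import Relation.Binary.PropositionalEquality
  using (_≡_; _≗_; refl; sym; trans; cong; cong₂; subst; subst₂; setoid; module ≡-Reasoning)
open import Relation.Nullary.Decidable using (Dec; yes; no; ¬?; _×-dec_)
open import Relation.Nullary.Negation using (¬_; contradiction)
open import Relation.Unary using (Pred; Decidable)

private
  variable
    n : ℕ

-- Counting by injections

count : {A : Set} {U : Pred A 0ℓ} → Decidable U → List A → ℕ
count U? xs = length (filter U? xs)

count-⇔ : {A : Set} {U Q : Pred A 0ℓ} (U? : Decidable U) (Q? : Decidable Q) →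
          (∀ {x} → U x → Q x) → (∀ {x} → Q x → U x) →
          ∀ xs → count U? xs ≡ count Q? xs
count-⇔ U? Q? U⊆Q Q⊆U xs = cong length (filter-≐ U? Q? (U⊆Q , Q⊆U) xs)

count-none : {A : Set} {U : Pred A 0ℓ} (U? : Decidable U) → (∀ {x} → ¬ U x) → ∀ xs → count U? xs ≡ 0
count-none U? ¬U xs = cong length (filter-none U? {xs} (All.universal (λ _ → ¬U) xs))

count-split : {A : Set} {U D : Pred A 0ℓ} (U? : Decidable U) (D? : Decidable D) →
              (∀ {x} → D x → U x) → ∀ xs →
              count U? xs ≡ count D? xs + count (λ x → U? x ×-dec ¬? (D? x)) xs
count-split U? D? D⊆U []       = refl
count-split U? D? D⊆U (x ∷ xs) with ih ← count-split U? D? D⊆U xs | D? x | U? x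
... | yes d | yes _ = cong suc ih
... | yes d | no ¬p = contradiction (D⊆U d) ¬p
... | no  _ | yes _ = trans (cong suc ih) (sym (ℕ.+-suc _ _))
... | no  _ | no  _ = ih

module _ (S : Setoid 0ℓ 0ℓ) where
  open Setoid S using (_≈_) renaming (sym to ≈-sym)
  open SetoidUnique S using (Unique)

  lookup-injective : ∀ {xs} → Unique xs → ∀ i j → lookup xs i ≈ lookup xs j → i ≡ j
  lookup-injective (_  ∷ _)   zero    zero    _  = refl
  lookup-injective (x≉ ∷ _)   zero    (suc j) eq = contradiction eq (All.lookup x≉ (∈-lookup j))
  lookup-injective (x≉ ∷ _)   (suc i) zero    eq = contradiction (≈-sym eq) (All.lookup x≉ (∈-lookup i))
  lookup-injective (_  ∷ xs!) (suc i) (suc j) eq = cong suc (lookup-injective xs! i j eq)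

module _ (S T : Setoid 0ℓ 0ℓ) {U : Pred (Setoid.Carrier S) 0ℓ} {Q : Pred (Setoid.Carrier T) 0ℓ}
         (U? : Decidable U) (Q? : Decidable Q) where
  private
    module S = Setoid S
    module T = Setoid T
  open SetoidUnique S using (Unique)
  open SetoidMembership T using (_∈_)

  -- `f` induces an injection between the positions of the two filtered lists. It may depend on the
  -- proof of `U x`, and setoids are used because permutations are compared pointwise. Bijections
  -- below are counted by two such inequalities.
  count-injective : ∀ {xs ys} → Unique xs → Q Respects T._≈_ → (∀ {y} → Q y → y ∈ ys) →
                    (f : ∀ {x} → U x → T.Carrier) → (∀ {x} (px : U x) → Q (f px)) →
                    (∀ {x x′} (px : U x) (px′ : U x′) → f px T.≈ f px′ → x S.≈ x′) →
                    count U? xs ≤ count Q? ys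
  count-injective {xs} {ys} xs! Q-resp Q⊆ys f Qf f-inj = Fin.injective⇒≤ index-injective
    where
    px : ∀ i → U (lookup (filter U? xs) i)
    px i = All.lookup (All.all-filter U? xs) (∈-lookup i)

    f∈ : ∀ i → f (px i) ∈ filter Q? ys
    f∈ i = SetoidMembershipₚ.∈-filter⁺ T Q? Q-resp (Q⊆ys (Qf (px i))) (Qf (px i))

    index : Fin (count U? xs) → Fin (count Q? ys)
    index i = Any.index (f∈ i)

    index-injective : ∀ {i j} → index i ≡ index j → i ≡ j
    index-injective {i} {j} eq =
      lookup-injective S (SetoidUniqueₚ.filter⁺ S U? xs!) i j (f-inj (px i) (px j)
        (T.trans (Any.lookup-index (f∈ i))
          (T.trans (T.reflexive (cong (lookup (filter Q? ys)) eq)) (T.sym (Any.lookup-index (f∈ j))))))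

-- Formal power series

-- Multiplication by `x^s`.
shift : ℕ → PowerSeries → PowerSeries
shift zero    f k       = f k
shift (suc s) f zero    = 0
shift (suc s) f (suc k) = shift s f k

shift-< : ∀ {s k} f → k < s → shift s f k ≡ 0
shift-< {suc s} {zero}  f _         = refl
shift-< {suc s} {suc k} f (s≤s k<s) = shift-< f k<s

shift-+ : ∀ s f k → shift s f (s + k) ≡ f k
shift-+ zero    f k = refl
shift-+ (suc s) f k = shift-+ s f k

-- The series are compared only at `k′` with `s + k′ ≡ k`, because the recursion for permutations is
-- available only under a bound on the number of inversions.
shift-cong : ∀ s k {f g} → (∀ k′ → s + k′ ≡ k → f k′ ≡ g k′) → shift s f k ≡ shift s g k
shift-cong zero    k       f≡g = f≡g k refl
shift-cong (suc s) zero    f≡g = refl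
shift-cong (suc s) (suc k) f≡g = shift-cong s k λ k′ eq → f≡g k′ (cong suc eq)

∑-cong : ∀ k {f g : ℕ → ℕ} → (∀ {i} → i ≤ k → f i ≡ g i) → ∑[0≤i≤ k ] f ≡ ∑[0≤i≤ k ] g
∑-cong zero    eq = cong (_+ 0) (eq z≤n)
∑-cong (suc k) eq = cong₂ _+_ (eq z≤n) (∑-cong k (eq ∘ s≤s))

∑-zero : ∀ k → ∑[0≤i≤ k ] (const 0) ≡ 0
∑-zero zero    = refl
∑-zero (suc k) = ∑-zero k

∑-+ : ∀ k (f g : ℕ → ℕ) → ∑[0≤i≤ k ] (λ i → f i + g i) ≡ ∑[0≤i≤ k ] f + ∑[0≤i≤ k ] g
∑-+ zero    f g = begin
  f 0 + g 0 + 0       ≡⟨ ℕ.+-identityʳ _ ⟩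
  f 0 + g 0           ≡⟨ cong₂ _+_ (ℕ.+-identityʳ (f 0)) (ℕ.+-identityʳ (g 0)) ⟨
  f 0 + 0 + (g 0 + 0) ∎
  where open ≡-Reasoning
∑-+ (suc k) f g = begin
  f 0 + g 0 + ∑[0≤i≤ k ] (λ i → f (suc i) + g (suc i))
    ≡⟨ cong (f 0 + g 0 +_) (∑-+ k (f ∘ suc) (g ∘ suc)) ⟩
  f 0 + g 0 + (∑[0≤i≤ k ] (f ∘ suc) + ∑[0≤i≤ k ] (g ∘ suc))
    ≡⟨ ℕ-+.interchange (f 0) (g 0) _ _ ⟩
  f 0 + ∑[0≤i≤ k ] (f ∘ suc) + (g 0 + ∑[0≤i≤ k ] (g ∘ suc)) ∎
  where
  open ≡-Reasoning
  module ℕ-+ = Algebra.Properties.CommutativeSemigroup ℕ.+-commutativeSemigroup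

⊛-distribʳ-+ : ∀ (f g h : PowerSeries) k → ((λ i → f i + g i) ⊛ h) k ≡ (f ⊛ h) k + (g ⊛ h) k
⊛-distribʳ-+ f g h k =
  trans (∑-cong k (λ {i} _ → ℕ.*-distribʳ-+ (h (k ∸ i)) (f i) (g i))) 
        (∑-+ k (λ i → f i * h (k ∸ i)) (λ i → g i * h (k ∸ i)))

shift-⊛ : ∀ s (f g : PowerSeries) → shift s f ⊛ g ≗ shift s (f ⊛ g)
shift-⊛ zero    f g k       = refl
shift-⊛ (suc s) f g zero    = refl
shift-⊛ (suc s) f g (suc k) = shift-⊛ s f g k

δ : PowerSeries
δ zero    = 1
δ (suc _) = 0

⊛-congˡ : ∀ {f g} (h : PowerSeries) → f ≗ g → f ⊛ h ≗ g ⊛ h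
⊛-congˡ h f≗g k = ∑-cong k (λ {i} _ → cong (_* h (k ∸ i)) (f≗g i))

⊛-identityˡ : ∀ f → δ ⊛ f ≗ f
⊛-identityˡ f zero    = trans (ℕ.+-identityʳ _) (ℕ.+-identityʳ (f 0))
⊛-identityˡ f (suc k) = trans (cong (f (suc k) + 0 +_) (∑-zero k)) (trans (ℕ.+-identityʳ _) (ℕ.+-identityʳ _))

⊛-identityʳ : ∀ f → f ⊛ δ ≗ f
⊛-identityʳ f zero    = trans (ℕ.+-identityʳ _) (ℕ.*-identityʳ (f 0))
⊛-identityʳ f (suc k) = cong₂ _+_ (ℕ.*-zeroʳ (f 0)) (⊛-identityʳ (f ∘ suc) k)

-- Partitions with bounded parts

-- Prepending `m` to the chain bounds the largest part by `m` and treats the empty partition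
-- uniformly.
IsBoundedPartition : ℕ → ℕ → List ℕ → Set
IsBoundedPartition m k xs = Linked _≥_ (m ∷ xs) × All (_> 0) xs × sum xs ≡ k

isBoundedPartition? : ∀ m k → Decidable (IsBoundedPartition m k)
isBoundedPartition? m k xs = linked? ℕ._≥?_ (m ∷ xs) ×-dec All.all? (ℕ._>? 0) xs ×-dec sum xs ℕ.≟ k

boundedPartitions : ℕ → PowerSeries
boundedPartitions m k = count (isBoundedPartition? m k) (compositions k)

boundedPartitions-complete : ∀ {m k xs} → IsBoundedPartition m k xs → xs ∈ₚ compositions k
boundedPartitions-complete (_ , pos , sum≡k) = compositions-complete _ _ pos sum≡k

boundedPartitions-zero : boundedPartitions 0 ≗ δ
boundedPartitions-zero zero    = refl
boundedPartitions-zero (suc k) = count-none (isBoundedPartition? 0 (suc k)) impossible (compositions (suc k))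
  where
  impossible : ∀ {xs} → ¬ IsBoundedPartition 0 (suc k) xs
  impossible {[]}     (_ , _ , ())
  impossible {x ∷ xs} (0≥x ∷ _ , x>0 ∷ _ , _) = ℕ.<⇒≱ x>0 0≥x

p≡boundedPartitions : ∀ {m k} → k ≤ m → p k ≡ boundedPartitions m k
p≡boundedPartitions {m} {k} k≤m =
  count-⇔ (isPartition? k) (isBoundedPartition? m k) bound (λ (dec , pos , eq) → Linked.tail dec , pos , eq) (compositions k)
  where
  bound : ∀ {xs} → IsPartition k xs → IsBoundedPartition m k xs
  bound {[]}     (_   , pos , eq) = [-] , pos , eq
  bound {x ∷ xs} (dec , pos , eq) =
    ℕ.≤-trans (ℕ.≤-trans (ℕ.m≤m+n x (sum xs)) (ℕ.≤-reflexive eq)) k≤m ∷ dec , pos , eq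

-- Either all parts are at most `m`, or the largest part is `suc m`; deleting one such part leaves a
-- partition whose parts are still at most `suc m`.
boundedPartitions-suc : ∀ m k → boundedPartitions (suc m) k ≡
                        boundedPartitions m k + shift (suc m) (boundedPartitions (suc m)) k
boundedPartitions-suc m k =
  trans (count-split (isBoundedPartition? (suc m) k) (isBoundedPartition? m k)
          (λ (dec , rest) → weaken dec , rest) (compositions k))
        (cong (boundedPartitions m k +_) (largest (suc m ℕ.≤? k)))
  where
  Largest : ℕ → List ℕ → Set
  Largest k xs = IsBoundedPartition (suc m) k xs × ¬ IsBoundedPartition m k xs

  largest? : ∀ k → Decidable (Largest k)
  largest? k xs = isBoundedPartition? (suc m) k xs ×-dec ¬? (isBoundedPartition? m k xs)

  weaken : ∀ {xs} → Linked _≥_ (m ∷ xs) → Linked _≥_ (suc m ∷ xs)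
  weaken [-]         = [-]
  weaken (m≥x ∷ dec) = ℕ.m≤n⇒m≤1+n m≥x ∷ dec

  head-largest : ∀ {k xs} → Largest k xs →
                 ∃ λ ys → xs ≡ suc m ∷ ys × Linked _≥_ (suc m ∷ ys) × All (_> 0) ys × suc m + sum ys ≡ k
  head-largest {xs = []}     ((_ , rest) , ¬bounded) = contradiction ([-] , rest) ¬bounded
  head-largest {xs = x ∷ xs} ((sm≥x ∷ dec , rest@(_ ∷ pos , eq)) , ¬bounded)
    with ℕ.m≤n⇒m<n∨m≡n sm≥x
  ... | inj₁ x<sm = contradiction (s≤s⁻¹ x<sm ∷ dec , rest) ¬bounded
  ... | inj₂ refl = xs , refl , dec , pos , eq

  unlargest : ∀ k′ → count (largest? (suc m + k′)) (compositions (suc m + k′)) ≡ boundedPartitions (suc m) k′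
  unlargest k′ = ℕ.≤-antisym
    (count-injective (setoid _) (setoid _) (largest? (suc m + k′)) (isBoundedPartition? (suc m) k′)
      (compositions-unique (suc m + k′)) (λ { refl → λ q → q }) boundedPartitions-complete
      (λ l → proj₁ (head-largest l))
      (λ l → let (_ , _ , dec , pos , eq) = head-largest l in dec , pos , ℕ.+-cancelˡ-≡ (suc m) _ _ eq)
      (λ l l′ eq → let (_ , xs≡ , _) = head-largest l ; (_ , xs′≡ , _) = head-largest l′ in
        trans xs≡ (trans (cong (suc m ∷_) eq) (sym xs′≡))))
    (count-injective (setoid _) (setoid _) (isBoundedPartition? (suc m) k′) (largest? (suc m + k′))
      (compositions-unique k′) (λ { refl → λ q → q }) (boundedPartitions-complete ∘ proj₁)
      (λ {xs} _ → suc m ∷ xs)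
      (λ (dec , pos , eq) → (ℕ.≤-refl ∷ dec , z<s ∷ pos , cong (suc m +_) eq)
                          , λ { (m≥sm ∷ _ , _) → ℕ.1+n≰n m≥sm })
      (λ { _ _ refl → refl }))

  largest : Dec (suc m ≤ k) → count (largest? k) (compositions k) ≡ shift (suc m) (boundedPartitions (suc m)) k
  largest (no sm≰k) = trans
    (count-none (largest? k) (λ l → let (ys , _ , _ , _ , eq) = head-largest l in
      sm≰k (ℕ.≤-trans (ℕ.m≤m+n (suc m) (sum ys)) (ℕ.≤-reflexive eq))) (compositions k))
    (sym (shift-< (boundedPartitions (suc m)) (ℕ.≰⇒> sm≰k)))
  largest (yes sm≤k) with ℕ.m≤n⇒∃[o]m+o≡n sm≤k
  ... | k′ , refl = trans (unlargest k′) (sym (shift-+ (suc m) (boundedPartitions (suc m)) k′))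

-- Permutations and inversions

module _ {U : Pred (Permutation′ n) 0ℓ} {m : ℕ} {V : Pred (Permutation′ m) 0ℓ}
         (U? : Decidable U) (V? : Decidable V) where

  count-permutations-≤ : V Respects _≈ₚ_ → (f : Permutation′ n → Permutation′ m) →
    (∀ {π} → U π → V (f π)) → (∀ {π ρ} → U π → U ρ → f π ≈ₚ f ρ → π ≈ₚ ρ) →
    count U? (permutations n) ≤ count V? (permutations m)
  count-permutations-≤ V-resp f Vf f-inj =
    count-injective (permutationSetoid n) (permutationSetoid m) U? V? (permutations-unique n)
      (λ {π} {ρ} → V-resp {π} {ρ}) (λ {ρ} _ → permutations-complete m ρ) (λ {π} _ → f π) Vf
      (λ {π} {ρ} → f-inj {π} {ρ})

module _ (π : Permutation′ n) where

  injective : ∀ {i j} → π ⟨$⟩ʳ i ≡ π ⟨$⟩ʳ j → i ≡ j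
  injective = Injection.injective (↔⇒↣ π)

inv-≤ : ∀ {m} (π : Permutation′ m) (ρ : Permutation′ n) (f : Fin m × Fin m → Fin n × Fin n) →
        (∀ {x} → IsInversion π x → IsInversion ρ (f x)) → (∀ {x y} → f x ≡ f y → x ≡ y) → inv π ≤ inv ρ
inv-≤ {n} {m} π ρ f inv-f f-inj =
  count-injective (setoid _) (setoid _) (isInversion? π) (isInversion? ρ)
    (Unique.cartesianProduct⁺ (Unique.allFin⁺ m) (Unique.allFin⁺ m)) (λ { refl q → q })
    (λ _ → ∈-cartesianProduct⁺ (∈-allFin _) (∈-allFin _))
    (λ {x} _ → f x) inv-f (λ _ _ → f-inj)

inv-cong : ∀ {π ρ : Permutation′ n} → π ≈ₚ ρ → inv π ≡ inv ρ
inv-cong {π = π} {ρ} π≈ρ = ℕ.≤-antisym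
  (inv-≤ π ρ (λ x → x) (λ (i<j , πi>πj) → i<j , subst₂ Fin._>_ (π≈ρ _) (π≈ρ _) πi>πj) (λ eq → eq))
  (inv-≤ ρ π (λ x → x) (λ (i<j , ρi>ρj) → i<j , subst₂ Fin._>_ (sym (π≈ρ _)) (sym (π≈ρ _)) ρi>ρj) (λ eq → eq))

opposite-mono-< : ∀ {i j : Fin n} → i Fin.< j → opposite j Fin.< opposite i
opposite-mono-< {n} {i} {j} i<j = subst₂ _<_ (sym (Fin.opposite-prop j)) (sym (Fin.opposite-prop i))
  (ℕ.∸-monoʳ-< (s≤s i<j) (Fin.toℕ<n j))

-- Rotation of the diagram by a half turn. It preserves the number of inversions and exchanges 132
-- with 213.
reverseComplement : Permutation′ n → Permutation′ n
reverseComplement π = reverse ∘ₚ π ∘ₚ reverse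

module _ (π : Permutation′ n) where
  private
    rcπ = reverseComplement π

  reverseComplement-opposite : ∀ i → rcπ ⟨$⟩ʳ opposite i ≡ opposite (π ⟨$⟩ʳ i)
  reverseComplement-opposite i = cong (λ j → opposite (π ⟨$⟩ʳ j)) (Fin.opposite-involutive i)

  reverseComplement-< : ∀ {i j} → π ⟨$⟩ʳ i Fin.< π ⟨$⟩ʳ j → rcπ ⟨$⟩ʳ opposite j Fin.< rcπ ⟨$⟩ʳ opposite i
  reverseComplement-< πi<πj = subst₂ Fin._<_ (sym (reverseComplement-opposite _)) (sym (reverseComplement-opposite _))
    (opposite-mono-< πi<πj)

  reverseComplement-involutive : reverseComplement rcπ ≈ₚ π
  reverseComplement-involutive i =
    trans (Fin.opposite-involutive _) (cong (π ⟨$⟩ʳ_) (Fin.opposite-involutive i))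

  inv-reverseComplement-≤ : inv π ≤ inv rcπ
  inv-reverseComplement-≤ = inv-≤ π rcπ (λ (i , j) → opposite j , opposite i)
    (λ (i<j , πi>πj) → opposite-mono-< i<j , reverseComplement-< πi>πj)
    (λ eq → cong₂ _,_ (opposite-injective (cong proj₂ eq)) (opposite-injective (cong proj₁ eq)))
    where
    opposite-injective : ∀ {i j : Fin n} → opposite i ≡ opposite j → i ≡ j
    opposite-injective eq =
      trans (sym (Fin.opposite-involutive _)) (trans (cong opposite eq) (Fin.opposite-involutive _))

inv-reverseComplement : ∀ (π : Permutation′ n) → inv (reverseComplement π) ≡ inv π
inv-reverseComplement π = ℕ.≤-antisym
  (ℕ.≤-trans (inv-reverseComplement-≤ (reverseComplement π))
    (ℕ.≤-reflexive (inv-cong {π = reverseComplement (reverseComplement π)} {π} (reverseComplement-involutive π))))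
  (inv-reverseComplement-≤ π)

reverseComplement-injective : ∀ {π ρ : Permutation′ n} → reverseComplement π ≈ₚ reverseComplement ρ → π ≈ₚ ρ
reverseComplement-injective {π = π} {ρ} eq i = trans (sym (reverseComplement-involutive π i))
  (trans (cong opposite (eq (opposite i))) (reverseComplement-involutive ρ i))

-- Inserting a first entry, and its effect on inversions

punchIn-< : ∀ (j : Fin (suc n)) {x y} → x Fin.< y → punchIn j x Fin.< punchIn j y
punchIn-< j {x} {y} x<y = ℕ.≰⇒> (ℕ.<⇒≱ x<y ∘ Fin.punchIn-cancel-≤ j y x)

punchIn-cancel-< : ∀ (j : Fin (suc n)) {x y} → punchIn j x Fin.< punchIn j y → x Fin.< y
punchIn-cancel-< j {x} {y} jx<jy = ℕ.≰⇒> (ℕ.<⇒≱ jx<jy ∘ Fin.punchIn-mono-≤ j y x)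

toℕ-punchIn-< : ∀ (j : Fin (suc n)) x → toℕ x < toℕ j → toℕ (punchIn j x) ≡ toℕ x
toℕ-punchIn-< (suc j) zero    _         = refl
toℕ-punchIn-< (suc j) (suc x) (s≤s x<j) = cong suc (toℕ-punchIn-< j x x<j)

toℕ-punchIn-≥ : ∀ (j : Fin (suc n)) x → toℕ j ≤ toℕ x → toℕ (punchIn j x) ≡ suc (toℕ x)
toℕ-punchIn-≥ zero    x       _         = refl
toℕ-punchIn-≥ (suc j) (suc x) (s≤s j≤x) = cong suc (toℕ-punchIn-≥ j x j≤x)

punchIn-above : ∀ (j : Fin (suc n)) {x} → toℕ j ≤ toℕ x → j Fin.< punchIn j x
punchIn-above j {x} j≤x = ℕ.≤-trans (s≤s j≤x) (ℕ.≤-reflexive (sym (toℕ-punchIn-≥ j x j≤x)))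

punchIn-above⁻¹ : ∀ (j : Fin (suc n)) {x} → j Fin.< punchIn j x → toℕ j ≤ toℕ x
punchIn-above⁻¹ j {x} j<jx = ℕ.≮⇒≥ λ x<j →
  ℕ.<-asym x<j (subst (toℕ j <_) (toℕ-punchIn-< j x x<j) j<jx)

module _ (j : Fin (suc n)) (ρ : Permutation′ n) where
  private
    π : Permutation′ (suc n)
    π = insert zero j ρ

    All² : List (Fin (suc n) × Fin (suc n))
    All² = cartesianProduct (allFin (suc n)) (allFin (suc n))

    All²-unique = Unique.cartesianProduct⁺ (Unique.allFin⁺ (suc n)) (Unique.allFin⁺ (suc n))

    FirstInversion LaterInversion : Fin (suc n) × Fin (suc n) → Set
    FirstInversion (i , i′) = i ≡ zero × IsInversion π (i , i′)
    LaterInversion (i , i′) = IsInversion π (i , i′) × ¬ FirstInversion (i , i′)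

    firstInversion? : Decidable FirstInversion
    firstInversion? (i , i′) = i Fin.≟ zero ×-dec isInversion? π (i , i′)

    laterInversion? : Decidable LaterInversion
    laterInversion? x = isInversion? π x ×-dec ¬? (firstInversion? x)

    true? : Decidable {A = Fin (toℕ j)} (λ _ → ⊤)
    true? _ = yes tt

    first : count firstInversion? All² ≡ toℕ j
    first = trans (ℕ.≤-antisym
      -- An inversion involving the first position is recorded by its smaller value, which can be
      -- any of the `toℕ j` letters below `j`.
      (count-injective (setoid _) (setoid _) firstInversion? true? All²-unique (λ _ _ → tt) (λ _ → ∈-allFin _)
        (λ q → fromℕ< (below q)) (λ _ → tt)
        (λ q q′ eq → cong₂ _,_ (trans (proj₁ q) (sym (proj₁ q′)))
          (injective π (Fin.toℕ-injective (Fin.fromℕ<-injective _ _ (below q) (below q′) eq)))))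
      (count-injective (setoid _) (setoid _) true? firstInversion? (Unique.allFin⁺ (toℕ j)) (λ { refl q → q })
        (λ _ → ∈-cartesianProduct⁺ (∈-allFin _) (∈-allFin _))
        (λ {x} _ → zero , position x) (λ {x} _ → refl , position>0 x , π-position< x)
        (λ {x} {x′} _ _ eq → Fin.toℕ-injective (trans (sym (π-position x))
          (trans (cong (λ y → toℕ (π ⟨$⟩ʳ proj₂ y)) eq) (π-position x′))))))
      (trans (cong length (filter-all true? (All.universal (λ _ → tt) (allFin (toℕ j))))) (length-tabulate _))
      where
      below : ∀ {x} → FirstInversion x → toℕ (π ⟨$⟩ʳ proj₂ x) < toℕ j
      below (refl , _ , j>πi) = j>πi

      value : Fin (toℕ j) → Fin (suc n)
      value x = fromℕ< (ℕ.<-trans (Fin.toℕ<n x) (Fin.toℕ<n j))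

      position : Fin (toℕ j) → Fin (suc n)
      position x = π ⟨$⟩ˡ value x

      π-position : ∀ x → toℕ (π ⟨$⟩ʳ position x) ≡ toℕ x
      π-position x = trans (cong toℕ (inverseʳ π)) (Fin.toℕ-fromℕ< _)

      π-position< : ∀ x → toℕ (π ⟨$⟩ʳ position x) < toℕ j
      π-position< x = subst (_< toℕ j) (sym (π-position x)) (Fin.toℕ<n x)

      position>0 : ∀ x → 0 < toℕ (position x)
      position>0 x with position x | π-position< x
      ... | zero  | j<j = contradiction j<j (ℕ.<-irrefl refl)
      ... | suc _ | _   = z<s

    later : count laterInversion? All² ≡ inv ρ
    later = ℕ.≤-antisym
      (count-injective (setoid _) (setoid _) laterInversion? (isInversion? ρ) All²-unique (λ { refl q → q })
        (λ _ → ∈-cartesianProduct⁺ (∈-allFin _) (∈-allFin _))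
        (λ l → proj₁ (lower l)) (λ l → proj₁ (proj₂ (lower l)))
        (λ l l′ eq → trans (proj₂ (proj₂ (lower l)))
          (trans (cong (λ (i , i′) → suc i , suc i′) eq) (sym (proj₂ (proj₂ (lower l′)))))))
      (count-injective (setoid _) (setoid _) (isInversion? ρ) laterInversion?
        (Unique.cartesianProduct⁺ (Unique.allFin⁺ n) (Unique.allFin⁺ n)) (λ { refl q → q })
        (λ _ → ∈-cartesianProduct⁺ (∈-allFin _) (∈-allFin _))
        (λ {(i , i′)} _ → suc i , suc i′)
        (λ (i<i′ , ρi>ρi′) → (s<s i<i′ , punchIn-< j ρi>ρi′) , λ ())
        (λ { _ _ refl → refl }))
      where
      lower : ∀ {x} → LaterInversion x → ∃ λ y → IsInversion ρ y × x ≡ (suc (proj₁ y) , suc (proj₂ y))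
      lower {zero  , _}      (inversion , ¬first) = contradiction (refl , inversion) ¬first
      lower {suc i , suc i′} ((i<i′ , πi>πi′) , _) = (i , i′) , (s<s⁻¹ i<i′ , punchIn-cancel-< j πi>πi′) , refl

  -- The first entry is inverted with exactly the `toℕ j` smaller letters; the remaining inversions
  -- are those of `ρ`, since `punchIn j` preserves order.
  inv-insert : inv (insert zero j ρ) ≡ toℕ j + inv ρ
  inv-insert = trans (count-split (isInversion? π) firstInversion? proj₂ All²) (cong₂ _+_ first later)

inv-remove : ∀ (π : Permutation′ (suc n)) → inv π ≡ toℕ (π ⟨$⟩ʳ zero) + inv (remove zero π)
inv-remove π = trans
  (sym (inv-cong {π = insert zero (π ⟨$⟩ʳ zero) (remove zero π)} {π} (insert-remove zero π)))
  (inv-insert (π ⟨$⟩ʳ zero) (remove zero π))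

inv≡0⇒id : ∀ {n} (π : Permutation′ n) → inv π ≡ 0 → π ≈ₚ id
inv≡0⇒id {suc n} π eq i = trans (sym (insert-remove zero π i)) (insert-id i)
  where
  head≡0 : π ⟨$⟩ʳ zero ≡ zero
  head≡0 = Fin.toℕ-injective (ℕ.m+n≡0⇒m≡0 _ (trans (sym (inv-remove π)) eq))

  insert-id : insert zero (π ⟨$⟩ʳ zero) (remove zero π) ≈ₚ id
  insert-id zero    = head≡0
  insert-id (suc i) = cong₂ punchIn head≡0
    (inv≡0⇒id (remove zero π) (ℕ.m+n≡0⇒n≡0 (toℕ (π ⟨$⟩ʳ zero)) (trans (sym (inv-remove π)) eq)) i)

inv-id : ∀ n → inv (id {n}) ≡ 0
inv-id n = count-none (isInversion? id) (λ (i<j , j<i) → ℕ.<-asym i<j j<i) (cartesianProduct (allFin n) (allFin n))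

-- Cuts of permutations into direct sums

-- For a permutation this is a direct sum decomposition whose first summand has `c` letters. The
-- trivial cut at 0 is allowed and starts the induction in `cut-≥`.
IsCut : ∀ {m} → (Fin n → Fin m) → ℕ → Set
IsCut v c = ∀ i → (toℕ i < c → toℕ (v i) < c) × (c ≤ toℕ i → c ≤ toℕ (v i))

insert-cut : ∀ (j : Fin (suc n)) (ρ : Permutation′ n) {c} → toℕ j ≤ c →
             IsCut (ρ ⟨$⟩ʳ_) c → IsCut (insert zero j ρ ⟨$⟩ʳ_) (suc c)
insert-cut j ρ j≤c cut zero    = (λ _ → s≤s j≤c) , λ ()
insert-cut j ρ j≤c cut (suc i) =
    (λ i<c → s≤s (ℕ.≤-trans (punchIn-≤ (ρ ⟨$⟩ʳ i)) (proj₁ (cut i) (s<s⁻¹ i<c))))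
  , (λ c≤i → let c≤ρi = proj₂ (cut i) (s≤s⁻¹ c≤i) in
      ℕ.≤-trans (s≤s c≤ρi) (ℕ.≤-reflexive (sym (toℕ-punchIn-≥ j _ (ℕ.≤-trans j≤c c≤ρi)))))
  where
  punchIn-≤ : ∀ x → toℕ (punchIn j x) ≤ suc (toℕ x)
  punchIn-≤ x with ℕ.<-≤-connex (toℕ x) (toℕ j)
  ... | inj₁ x<j = ℕ.≤-trans (ℕ.≤-reflexive (toℕ-punchIn-< j x x<j)) (ℕ.n≤1+n _)
  ... | inj₂ j≤x = ℕ.≤-reflexive (toℕ-punchIn-≥ j x j≤x)

cut-resp : ∀ {m} {v w : Fin n → Fin m} {c} → v ≗ w → IsCut v c → IsCut w c
cut-resp {c = c} v≗w cut i = subst (λ x → (toℕ i < c → toℕ x < c) × (c ≤ toℕ i → c ≤ toℕ x)) (v≗w i) (cut i)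

-- Induction on the size. Deleting the first entry `j` loses `j` inversions and one letter, so the
-- threshold `suc t` may be replaced by `j + t` for the rest. A cut of the rest at some `c ≥ j`
-- becomes a cut at `suc c` once `j` is put back. Asking for more than `t` is what keeps `j` below
-- the cut.
cut-≥ : ∀ {n} (π : Permutation′ n) t → inv π + t < n → ∃ λ c → t ≤ c × c < n × IsCut (π ⟨$⟩ʳ_) c
cut-≥ {suc n} π zero    _     = 0 , z≤n , z<s , λ _ → (λ ()) , λ _ → z≤n
cut-≥ {suc n} π (suc t) inv<n =
  let (c , j+t≤c , c<n , cut) = cut-≥ (remove zero π) (j + t) rest<n
  in suc c , s≤s (ℕ.m+n≤o⇒n≤o j j+t≤c) , s<s c<n
   , cut-resp (insert-remove zero π) (insert-cut (π ⟨$⟩ʳ zero) (remove zero π) (ℕ.m+n≤o⇒m≤o j j+t≤c) cut)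
  where
  j = toℕ (π ⟨$⟩ʳ zero)

  rest<n : inv (remove zero π) + (j + t) < n
  rest<n = s<s⁻¹ (subst (_< suc n) eq inv<n)
    where
    open ≡-Reasoning
    eq : inv π + suc t ≡ suc (inv (remove zero π) + (j + t))
    eq = begin
      inv π + suc t                        ≡⟨ ℕ.+-suc (inv π) t ⟩
      suc (inv π + t)                      ≡⟨ cong (λ i → suc (i + t)) (inv-remove π) ⟩
      suc (j + inv (remove zero π) + t)    ≡⟨ cong (λ i → suc (i + t)) (ℕ.+-comm j _) ⟩
      suc (inv (remove zero π) + j + t)    ≡⟨ cong suc (ℕ.+-assoc _ j t) ⟩
      suc (inv (remove zero π) + (j + t))  ∎

-- Threshold 1 excludes the trivial cut at 0, so both summands are nonempty.
few-inversions⇒cut : ∀ (π : Permutation′ n) → inv π + 2 ≤ n → ∃ λ c → 0 < c × c < n × IsCut (π ⟨$⟩ʳ_) c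
few-inversions⇒cut {n} π inv+2≤n = cut-≥ π 1 (subst (_≤ n) (ℕ.+-suc (inv π) 1) inv+2≤n)

-- Patterns

-- Positions are chained first, then the values in increasing order. Taking arbitrary functions lets
-- occurrences be transported along pointwise equalities and order-preserving maps.
Has132 Has213 Has1324 : ∀ {m} → (Fin n → Fin m) → Set
Has132  v = ∃ λ a → ∃ λ b → ∃ λ c → a Fin.< b × b Fin.< c × v a Fin.< v c × v c Fin.< v b
Has213  v = ∃ λ a → ∃ λ b → ∃ λ c → a Fin.< b × b Fin.< c × v b Fin.< v a × v a Fin.< v c
Has1324 v = ∃ λ a → ∃ λ b → ∃ λ c → ∃ λ d →
  a Fin.< b × b Fin.< c × c Fin.< d × v a Fin.< v c × v c Fin.< v b × v b Fin.< v d

has132? : ∀ {m} → Decidable (Has132 {n} {m})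
has132? v = Fin.any? λ a → Fin.any? λ b → Fin.any? λ c →
  a Fin.<? b ×-dec b Fin.<? c ×-dec v a Fin.<? v c ×-dec v c Fin.<? v b

has1324? : ∀ {m} → Decidable (Has1324 {n} {m})
has1324? v = Fin.any? λ a → Fin.any? λ b → Fin.any? λ c → Fin.any? λ d →
  a Fin.<? b ×-dec b Fin.<? c ×-dec c Fin.<? d ×-dec v a Fin.<? v c ×-dec v c Fin.<? v b ×-dec v b Fin.<? v d

module _ {m n′ m′} {v : Fin n → Fin m} {w : Fin n′ → Fin m′} (f : Fin n → Fin n′)
         (f-mono : ∀ {i j} → i Fin.< j → f i Fin.< f j)
         (f-values : ∀ {i j} → v i Fin.< v j → w (f i) Fin.< w (f j)) where

  has132-embed : Has132 v → Has132 w
  has132-embed (a , b , c , a<b , b<c , va<vc , vc<vb) =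
    f a , f b , f c , f-mono a<b , f-mono b<c , f-values va<vc , f-values vc<vb

  has213-embed : Has213 v → Has213 w
  has213-embed (a , b , c , a<b , b<c , vb<va , va<vc) =
    f a , f b , f c , f-mono a<b , f-mono b<c , f-values vb<va , f-values va<vc

  has1324-embed : Has1324 v → Has1324 w
  has1324-embed (a , b , c , d , a<b , b<c , c<d , va<vc , vc<vb , vb<vd) =
    f a , f b , f c , f d , f-mono a<b , f-mono b<c , f-mono c<d , f-values va<vc , f-values vc<vb , f-values vb<vd

module _ {m} {v w : Fin n → Fin m} (v≗w : v ≗ w) where
  private
    transport : ∀ {i j} → v i Fin.< v j → w i Fin.< w j
    transport = subst₂ Fin._<_ (v≗w _) (v≗w _)

  has132-resp : Has132 v → Has132 w
  has132-resp = has132-embed (λ i → i) (λ i<j → i<j) transport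

  has213-resp : Has213 v → Has213 w
  has213-resp = has213-embed (λ i → i) (λ i<j → i<j) transport

  has1324-resp : Has1324 v → Has1324 w
  has1324-resp = has1324-embed (λ i → i) (λ i<j → i<j) transport

module _ (π : Permutation′ n) where

  has132⇒has213-reverseComplement : Has132 (π ⟨$⟩ʳ_) → Has213 (reverseComplement π ⟨$⟩ʳ_)
  has132⇒has213-reverseComplement (a , b , c , a<b , b<c , πa<πc , πc<πb) =
    opposite c , opposite b , opposite a , opposite-mono-< b<c , opposite-mono-< a<b
    , reverseComplement-< π πc<πb , reverseComplement-< π πa<πc

  has213⇒has132-reverseComplement : Has213 (π ⟨$⟩ʳ_) → Has132 (reverseComplement π ⟨$⟩ʳ_)
  has213⇒has132-reverseComplement (a , b , c , a<b , b<c , πb<πa , πa<πc) =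
    opposite c , opposite b , opposite a , opposite-mono-< b<c , opposite-mono-< a<b
    , reverseComplement-< π πa<πc , reverseComplement-< π πb<πa

module _ {m} (q : Permutation′ m) (π : Permutation′ n) where

  -- Two chains suffice: the positions in order, and the values sorted by the inverse of `q`. That
  -- `π` in turn reflects the order follows by trichotomy and the injectivity of `q`.
  contains⁺ : (f : Vec (Fin n) m) → VecLinked Fin._<_ f →
              VecLinked Fin._<_ (Vec.tabulate λ i → π ⟨$⟩ʳ Vec.lookup f (q ⟨$⟩ˡ i)) → Contains π q
  contains⁺ f f↑ values↑ = Vec.lookup f , (λ i j → lookup⁺ ℕ.<-trans f↑) , λ i j → mk⇔ mono (cancel i j)
    where
    values : Fin m → Fin n
    values i = π ⟨$⟩ʳ Vec.lookup f (q ⟨$⟩ˡ i)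

    values-q : ∀ i → Vec.lookup (Vec.tabulate values) (q ⟨$⟩ʳ i) ≡ π ⟨$⟩ʳ Vec.lookup f i
    values-q i = trans (lookup∘tabulate values (q ⟨$⟩ʳ i)) (cong (λ j → π ⟨$⟩ʳ Vec.lookup f j) (inverseˡ q))

    mono : ∀ {i j} → q ⟨$⟩ʳ i Fin.< q ⟨$⟩ʳ j → π ⟨$⟩ʳ Vec.lookup f i Fin.< π ⟨$⟩ʳ Vec.lookup f j
    mono {i} {j} qi<qj = subst₂ Fin._<_ (values-q i) (values-q j) (lookup⁺ ℕ.<-trans values↑ qi<qj)

    cancel : ∀ i j → π ⟨$⟩ʳ Vec.lookup f i Fin.< π ⟨$⟩ʳ Vec.lookup f j → q ⟨$⟩ʳ i Fin.< q ⟨$⟩ʳ j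
    cancel i j πi<πj with Fin.<-cmp (q ⟨$⟩ʳ i) (q ⟨$⟩ʳ j)
    ... | tri< qi<qj _ _ = qi<qj
    ... | tri≈ _ qi≡qj _ = contradiction πi<πj (ℕ.<-irrefl (cong (λ x → toℕ (π ⟨$⟩ʳ Vec.lookup f x)) (injective q qi≡qj)))
    ... | tri> _ _ qi>qj = contradiction πi<πj (ℕ.<-asym (mono qi>qj))

module _ (π : Permutation′ n) where

  contains1324⇒has1324 : Contains π (proj₂ pattern1324) → Has1324 (π ⟨$⟩ʳ_)
  contains1324⇒has1324 (f , f↑ , iso) =
    f 0F , f 1F , f 2F , f 3F , f↑ 0F 1F (s≤s z≤n) , f↑ 1F 2F (s≤s (s≤s z≤n)) , f↑ 2F 3F (s≤s (s≤s (s≤s z≤n)))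
    , Equivalence.to (iso 0F 2F) (s≤s z≤n) , Equivalence.to (iso 2F 1F) (s≤s (s≤s z≤n))
    , Equivalence.to (iso 1F 3F) (s≤s (s≤s (s≤s z≤n)))

  has1324⇒contains1324 : Has1324 (π ⟨$⟩ʳ_) → Contains π (proj₂ pattern1324)
  has1324⇒contains1324 (a , b , c , d , a<b , b<c , c<d , πa<πc , πc<πb , πb<πd) =
    contains⁺ (proj₂ pattern1324) π (a ∷ b ∷ c ∷ d ∷ []) (a<b ∷ b<c ∷ c<d ∷ [-]) (πa<πc ∷ πc<πb ∷ πb<πd ∷ [-])

  -- If a 2413 lies before the cut, its letters 2, 4, 3 form a 132, which the entry at the cut
  -- position completes to a 1324. If it lies after the cut, its letters 2, 1, 3 form a 213, which
  -- the first entry of `π` completes.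
  cut⇒avoids2413 : ∀ {c} → 0 < c → c < n → IsCut (π ⟨$⟩ʳ_) c → ¬ Has1324 (π ⟨$⟩ʳ_) → Avoids π pattern2413
  cut⇒avoids2413 {m} 0<m m<n cut ¬1324 (f , f↑ , iso) with ℕ.<-≤-connex (toℕ (f 3F)) m | ℕ.<-≤-connex (toℕ (f 0F)) m
  ... | inj₁ d<m | _        = ¬1324
    ( f 0F , f 1F , f 3F , last , f↑ 0F 1F (s≤s z≤n) , f↑ 1F 3F (s≤s (s≤s z≤n))
    , subst (toℕ (f 3F) <_) (sym (Fin.toℕ-fromℕ< m<n)) d<m
    , Equivalence.to (iso 0F 3F) (s≤s (s≤s z≤n)) , Equivalence.to (iso 3F 1F) (s≤s (s≤s (s≤s z≤n)))
    , ℕ.<-≤-trans (proj₁ (cut (f 1F)) (ℕ.<-trans (f↑ 1F 3F (s≤s (s≤s z≤n))) d<m))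
        (proj₂ (cut last) (ℕ.≤-reflexive (sym (Fin.toℕ-fromℕ< m<n)))) )
    where last = fromℕ< m<n
  ... | inj₂ _   | inj₂ m≤a = ¬1324
    ( first , f 0F , f 2F , f 3F , ℕ.<-≤-trans first<m m≤a , f↑ 0F 2F (s≤s z≤n) , f↑ 2F 3F (s≤s (s≤s (s≤s z≤n)))
    , ℕ.<-≤-trans (proj₁ (cut first) first<m) (proj₂ (cut (f 2F)) (ℕ.≤-trans m≤a (ℕ.<⇒≤ (f↑ 0F 2F (s≤s z≤n)))))
    , Equivalence.to (iso 2F 0F) (s≤s z≤n) , Equivalence.to (iso 0F 3F) (s≤s (s≤s z≤n)) )
    where
    first = fromℕ< (ℕ.<-trans 0<m m<n)
    first<m : toℕ first < m
    first<m = subst (_< m) (sym (Fin.toℕ-fromℕ< (ℕ.<-trans 0<m m<n))) 0<m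
  -- The occurrence cannot straddle the cut: the letter 1 has a value below that of 2, hence below
  -- `m`, yet it stands to the right of 4, which lies after the cut because its value exceeds that
  -- of 3.
  ... | inj₂ m≤d | inj₁ a<m = ℕ.<⇒≱ πc<m (proj₂ (cut (f 2F)) m≤c)
    where
    πc<m : toℕ (π ⟨$⟩ʳ f 2F) < m
    πc<m = ℕ.<-trans (Equivalence.to (iso 2F 0F) (s≤s z≤n)) (proj₁ (cut (f 0F)) a<m)
    m≤b : m ≤ toℕ (f 1F)
    m≤b = ℕ.≮⇒≥ λ b<m → ℕ.<⇒≱ (proj₁ (cut (f 1F)) b<m)
      (ℕ.≤-trans (proj₂ (cut (f 3F)) m≤d) (ℕ.<⇒≤ (Equivalence.to (iso 3F 1F) (s≤s (s≤s (s≤s z≤n))))))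
    m≤c : m ≤ toℕ (f 2F)
    m≤c = ℕ.≤-trans m≤b (ℕ.<⇒≤ (f↑ 1F 2F (s≤s (s≤s z≤n))))

-- Patterns after inserting a first entry

module _ (j : Fin (suc (suc n))) (ρ : Permutation′ (suc n)) where
  private
    π : Permutation′ (suc (suc n))
    π = insert zero j ρ

    module Ascent (j<ρ0 : toℕ j < toℕ (ρ ⟨$⟩ʳ zero)) where
      j<1+n : toℕ j < suc n
      j<1+n = ℕ.<-trans j<ρ0 (Fin.toℕ<n (ρ ⟨$⟩ʳ zero))

      -- π = insert zero j ρ takes the value j + 1 at suc next.
      next : Fin (suc n)
      next = ρ ⟨$⟩ˡ fromℕ< j<1+n

      ρ-next : toℕ (ρ ⟨$⟩ʳ next) ≡ toℕ j
      ρ-next = trans (cong toℕ (inverseʳ ρ)) (Fin.toℕ-fromℕ< j<1+n)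

      next>0 : 0 < toℕ next
      next>0 with next | ρ-next
      ... | zero  | ρ0≡j = contradiction j<ρ0 (ℕ.<-irrefl (sym ρ0≡j))
      ... | suc _ | _    = z<s

      j<π-next : toℕ j < toℕ (π ⟨$⟩ʳ suc next)
      j<π-next = punchIn-above j (ℕ.≤-reflexive (sym ρ-next))

      π-next<π1 : π ⟨$⟩ʳ suc next Fin.< π ⟨$⟩ʳ suc zero
      π-next<π1 = punchIn-< j (subst (_< toℕ (ρ ⟨$⟩ʳ zero)) (sym ρ-next) j<ρ0)

    module NoAscent (ρ0≤j : toℕ (ρ ⟨$⟩ʳ zero) ≤ toℕ j) where
      ρ0<ρ : ∀ {b c : Fin (suc n)} → b Fin.< c → j Fin.< π ⟨$⟩ʳ suc c → ρ ⟨$⟩ʳ zero Fin.< ρ ⟨$⟩ʳ c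
      -- An entry of `π` above `j` comes from an entry of `ρ` that is at least `j`; strictness comes
      -- from the injectivity of `ρ`, as position `suc c` is not the first.
      ρ0<ρ {c = suc c} _ j<πc = ℕ.≤∧≢⇒< (ℕ.≤-trans ρ0≤j (punchIn-above⁻¹ j j<πc))
        λ eq → contradiction (injective ρ (Fin.toℕ-injective eq)) λ ()

      0<position : ∀ {b c} → ρ ⟨$⟩ʳ zero Fin.< ρ ⟨$⟩ʳ c → ρ ⟨$⟩ʳ c Fin.< ρ ⟨$⟩ʳ b → 0 < toℕ b
      0<position {zero}  ρ0<ρc ρc<ρ0 = contradiction ρc<ρ0 (ℕ.<-asym ρ0<ρc)
      0<position {suc b} _     _     = z<s

  has132-insert : Has132 (ρ ⟨$⟩ʳ_) → Has132 (π ⟨$⟩ʳ_)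
  has132-insert = has132-embed suc s<s (punchIn-< j)

  has1324-insert : Has1324 (ρ ⟨$⟩ʳ_) → Has1324 (π ⟨$⟩ʳ_)
  has1324-insert = has1324-embed suc s<s (punchIn-< j)

  -- An occurrence that starts at `j` can start at the first entry of `ρ` instead: this entry is at
  -- most `j`, hence below the other two letters. It is not itself the letter 3, being smaller than
  -- the letter 2.
  has132-insert⁻¹ : toℕ (ρ ⟨$⟩ʳ zero) ≤ toℕ j → Has132 (π ⟨$⟩ʳ_) → Has132 (ρ ⟨$⟩ʳ_)
  has132-insert⁻¹ ρ0≤j (zero , suc b , suc c , _ , b<c , j<πc , πc<πb) =
    let ρ0<ρc = ρ0<ρ (s<s⁻¹ b<c) j<πc ; ρc<ρb = punchIn-cancel-< j πc<πb in
    zero , b , c , 0<position ρ0<ρc ρc<ρb , s<s⁻¹ b<c , ρ0<ρc , ρc<ρb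
    where open NoAscent ρ0≤j
  has132-insert⁻¹ ρ0≤j (suc a , suc b , suc c , a<b , b<c , πa<πc , πc<πb) =
    a , b , c , s<s⁻¹ a<b , s<s⁻¹ b<c , punchIn-cancel-< j πa<πc , punchIn-cancel-< j πc<πb

  has1324-insert⁻¹ : toℕ (ρ ⟨$⟩ʳ zero) ≤ toℕ j → Has1324 (π ⟨$⟩ʳ_) → Has1324 (ρ ⟨$⟩ʳ_)
  has1324-insert⁻¹ ρ0≤j (zero , suc b , suc c , suc d , _ , b<c , c<d , j<πc , πc<πb , πb<πd) =
    let ρ0<ρc = ρ0<ρ (s<s⁻¹ b<c) j<πc ; ρc<ρb = punchIn-cancel-< j πc<πb in
    zero , b , c , d , 0<position ρ0<ρc ρc<ρb , s<s⁻¹ b<c , s<s⁻¹ c<d , ρ0<ρc , ρc<ρb , punchIn-cancel-< j πb<πd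
    where open NoAscent ρ0≤j
  has1324-insert⁻¹ ρ0≤j (suc a , suc b , suc c , suc d , a<b , b<c , c<d , πa<πc , πc<πb , πb<πd) =
    a , b , c , d , s<s⁻¹ a<b , s<s⁻¹ b<c , s<s⁻¹ c<d
    , punchIn-cancel-< j πa<πc , punchIn-cancel-< j πc<πb , punchIn-cancel-< j πb<πd

  -- The first entry `j`, the second entry and the later entry with value `j + 1` form a 132.
  ascent⇒has132 : toℕ j < toℕ (ρ ⟨$⟩ʳ zero) → Has132 (π ⟨$⟩ʳ_)
  ascent⇒has132 j<ρ0 = zero , suc zero , suc next , z<s , s<s next>0 , j<π-next , π-next<π1
    where open Ascent j<ρ0

  -- The 132 made by the ascent lies wholly before the cut, so the entry at position `c` serves as
  -- the 4.
  ascent∧cut⇒has1324 : ∀ {c} → 0 < toℕ j → 0 < c → c < suc (suc n) → IsCut (π ⟨$⟩ʳ_) c →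
                       toℕ j < toℕ (ρ ⟨$⟩ʳ zero) → Has1324 (π ⟨$⟩ʳ_)
  ascent∧cut⇒has1324 {c} 0<j 0<c c<2+n cut j<ρ0 =
    zero , suc zero , suc next , last , z<s , s<s next>0
    , subst (toℕ (suc next) <_) (sym (Fin.toℕ-fromℕ< c<2+n)) next<c
    , j<π-next , π-next<π1 , ℕ.<-≤-trans π1<c (proj₂ (cut last) (ℕ.≤-reflexive (sym (Fin.toℕ-fromℕ< c<2+n))))
    where
    open Ascent j<ρ0
    last = fromℕ< c<2+n

    π1<c : toℕ (π ⟨$⟩ʳ suc zero) < c
    -- The cut gives `toℕ j < c`, and `0 < toℕ j` then gives `1 < c`: the second position also lies
    -- before the cut.
    π1<c = proj₁ (cut (suc zero)) (ℕ.≤-<-trans 0<j (proj₁ (cut zero) 0<c))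

    next<c : toℕ (suc next) < c
    next<c = ℕ.≰⇒> λ c≤next → ℕ.<⇒≱ (ℕ.<-trans π-next<π1 π1<c) (proj₂ (cut (suc next)) c≤next)

insert-0-has1324⁻¹ : ∀ (ρ : Permutation′ n) → Has1324 (insert zero zero ρ ⟨$⟩ʳ_) → Has213 (ρ ⟨$⟩ʳ_)
insert-0-has1324⁻¹ ρ (_ , suc b , suc c , suc d , _ , b<c , c<d , _ , πc<πb , πb<πd) =
  b , c , d , s<s⁻¹ b<c , s<s⁻¹ c<d , s<s⁻¹ πc<πb , s<s⁻¹ πb<πd

insert-0-has1324 : ∀ (ρ : Permutation′ n) → Has213 (ρ ⟨$⟩ʳ_) → Has1324 (insert zero zero ρ ⟨$⟩ʳ_)
insert-0-has1324 ρ (b , c , d , b<c , c<d , ρc<ρb , ρb<ρd) =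
  zero , suc b , suc c , suc d , z<s , s<s b<c , s<s c<d , z<s , s<s ρc<ρb , s<s ρb<ρd

-- Removing first entries

-- The size condition inv + e ≤ n is inherited by the permutation left after
-- deleting a nonzero first entry, so A is only ever used within it.
module FirstEntry
  (A : ∀ {n} → Pred (Permutation′ n) 0ℓ) (A? : ∀ {n} → Decidable (A {n}))
  (A-resp : ∀ {n} {π ρ : Permutation′ n} → π ≈ₚ ρ → A π → A ρ)
  (e : ℕ) (0<e : 0 < e)
  (A-insert : ∀ {n} (j : Fin (suc (suc n))) (ρ : Permutation′ (suc n)) → 0 < toℕ j →
              inv (insert zero j ρ) + e ≤ suc (suc n) →
              A (insert zero j ρ) ⇔ (A ρ × toℕ (ρ ⟨$⟩ʳ zero) ≤ toℕ j))
  where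

  -- The bound on the first entry plays the part of the bound on the largest part in
  -- `IsBoundedPartition`.
  HeadAtMost : ℕ → ℕ → Pred (Permutation′ (suc n)) 0ℓ
  HeadAtMost m k π = inv π ≡ k × A π × toℕ (π ⟨$⟩ʳ zero) ≤ m

  headAtMost? : ∀ m k → Decidable (HeadAtMost {n} m k)
  headAtMost? m k π = inv π ℕ.≟ k ×-dec A? π ×-dec toℕ (π ⟨$⟩ʳ zero) ℕ.≤? m

  headAtMost-resp : ∀ m k → HeadAtMost {n} m k Respects _≈ₚ_
  headAtMost-resp m k {π} {ρ} π≈ρ (inv≡k , a , π0≤m) =
    trans (sym (inv-cong {π = π} {ρ} π≈ρ)) inv≡k , A-resp {π = π} {ρ} π≈ρ a
    , subst (λ x → toℕ x ≤ m) (π≈ρ zero) π0≤m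

  headsAtMost : ℕ → ℕ → PowerSeries
  headsAtMost n m k = count (headAtMost? m k) (permutations (suc n))

  private
    -- First entry exactly `suc m`, written as the difference that `count-split` produces.
    Head : ℕ → ℕ → Pred (Permutation′ (suc n)) 0ℓ
    Head m k π = HeadAtMost (suc m) k π × ¬ HeadAtMost m k π

    head? : ∀ m k → Decidable (Head {n} m k)
    head? m k π = headAtMost? (suc m) k π ×-dec ¬? (headAtMost? m k π)

    head-≡ : ∀ {m k} {π : Permutation′ (suc n)} → Head m k π → toℕ (π ⟨$⟩ʳ zero) ≡ suc m
    head-≡ ((inv≡k , a , π0≤1+m) , ¬π0≤m) =
      ℕ.≤-antisym π0≤1+m (ℕ.≰⇒> λ π0≤m → ¬π0≤m (inv≡k , a , π0≤m))

    head-resp : ∀ m k → Head {n} m k Respects _≈ₚ_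
    head-resp m k {π} {ρ} π≈ρ (h , ¬h) =
      headAtMost-resp (suc m) k {π} {ρ} π≈ρ h , ¬h ∘ headAtMost-resp m k {ρ} {π} (sym ∘ π≈ρ)

    -- Deleting the first entry `suc m` removes `suc m` inversions, and `A-insert` says that what
    -- remains has first entry at most `suc m`. Inserting `suc m` again is the inverse map.
    unhead : ∀ {n} m k → suc m + k + e ≤ suc (suc n) →
             count (head? m (suc m + k)) (permutations (suc (suc n))) ≡ headsAtMost n (suc m) k
    unhead {n} m k size = ℕ.≤-antisym
      (count-permutations-≤ (head? m (suc m + k)) (headAtMost? (suc m) k)
        (λ {π} {ρ} → headAtMost-resp (suc m) k {π} {ρ})
        (remove zero) (λ {π} → remove-head π) (λ {π} {ρ} → remove-injective π ρ))
      (count-permutations-≤ (headAtMost? (suc m) k) (head? m (suc m + k))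
        (λ {π} {ρ} → head-resp m (suc m + k) {π} {ρ})
        (insert zero j) (λ {ρ} → insert-head ρ)
        (λ {π} {ρ} _ _ → proj₂ ∘ insert-injective {j = j} {j} {π} {ρ}))
      where
      -- The size bound together with `0 < e` ensures that `suc m` is a letter.
      1+m<2+n : suc m < suc (suc n)
      1+m<2+n = ℕ.≤-trans (ℕ.≤-trans (s≤s (ℕ.m≤m+n (suc m) k))
        (ℕ.≤-trans (ℕ.≤-reflexive (ℕ.+-comm 1 (suc m + k))) (ℕ.+-monoʳ-≤ (suc m + k) 0<e))) size

      j : Fin (suc (suc n))
      j = fromℕ< 1+m<2+n

      toℕ-j : toℕ j ≡ suc m
      toℕ-j = Fin.toℕ-fromℕ< 1+m<2+n

      remove-head : ∀ π → Head m (suc m + k) π → HeadAtMost (suc m) k (remove zero π)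
      remove-head π h@((inv≡ , a , _) , _) =
          ℕ.+-cancelˡ-≡ (suc m) _ _ (trans (trans (cong (_+ inv ρ) (sym (head-≡ h))) (sym (inv-remove π))) inv≡)
        , let (a′ , ρ0≤) = Equivalence.to (A-insert (π ⟨$⟩ʳ zero) ρ (subst (0 <_) (sym (head-≡ h)) z<s) size′)
                             (A-resp {π = π} {π′} (sym ∘ insert-remove zero π) a)
          in a′ , subst (toℕ (ρ ⟨$⟩ʳ zero) ≤_) (head-≡ h) ρ0≤
        where
        ρ  = remove zero π
        π′ = insert zero (π ⟨$⟩ʳ zero) ρ
        size′ : inv π′ + e ≤ suc (suc n)
        size′ = subst (λ i → i + e ≤ suc (suc n)) (sym (trans (inv-cong {π = π′} {π} (insert-remove zero π)) inv≡)) size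

      remove-injective : ∀ π ρ → Head m (suc m + k) π → Head m (suc m + k) ρ →
                         remove zero π ≈ₚ remove zero ρ → π ≈ₚ ρ
      remove-injective π ρ hπ hρ eq i = trans (sym (insert-remove zero π i))
        (trans (insert-cong {π = remove zero π} {remove zero ρ}
                 (Fin.toℕ-injective (trans (head-≡ hπ) (sym (head-≡ hρ)))) eq i)
          (insert-remove zero ρ i))

      insert-head : ∀ ρ → HeadAtMost (suc m) k ρ → Head m (suc m + k) (insert zero j ρ)
      insert-head ρ (inv≡k , a , ρ0≤1+m) =
          ( inv≡ , Equivalence.from (A-insert j ρ (subst (0 <_) (sym toℕ-j) z<s)
                     (subst (λ i → i + e ≤ suc (suc n)) (sym inv≡) size))
                     (a , subst (toℕ (ρ ⟨$⟩ʳ zero) ≤_) (sym toℕ-j) ρ0≤1+m)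
          , ℕ.≤-reflexive toℕ-j )
        , λ (_ , _ , j≤m) → ℕ.1+n≰n (subst (_≤ m) toℕ-j j≤m)
        where
        inv≡ : inv (insert zero j ρ) ≡ suc m + k
        inv≡ = trans (inv-insert j ρ) (cong₂ _+_ toℕ-j inv≡k)

    head-none : ∀ {n m k} → k < suc m → count (head? m k) (permutations (suc n)) ≡ 0
    head-none {n} {m} {k} k<1+m = count-none (head? m k) (λ {π} h@((inv≡k , _) , _) →
      ℕ.<⇒≱ k<1+m (ℕ.≤-trans (ℕ.≤-reflexive (sym (head-≡ h)))
        (ℕ.≤-trans (ℕ.m≤m+n _ (inv (remove zero π))) (ℕ.≤-reflexive (trans (sym (inv-remove π)) inv≡k)))))
      (permutations (suc n))

  -- The recursion of `boundedPartitions-suc`, with one letter fewer in the shifted term.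
  headsAtMost-suc : ∀ n m k → k + e ≤ suc (suc n) → headsAtMost (suc n) (suc m) k ≡
                    headsAtMost (suc n) m k + shift (suc m) (headsAtMost n (suc m)) k
  headsAtMost-suc n m k size =
    trans (count-split (headAtMost? (suc m) k) (headAtMost? m k)
            (λ (inv≡k , a , π0≤m) → inv≡k , a , ℕ.m≤n⇒m≤1+n π0≤m) (permutations (suc (suc n))))
          (cong (headsAtMost (suc n) m k +_) (headEqual (suc m ℕ.≤? k)))
    where
    headEqual : Dec (suc m ≤ k) → count (head? m k) (permutations (suc (suc n))) ≡ shift (suc m) (headsAtMost n (suc m)) k
    headEqual (no 1+m≰k) =
      trans (head-none {suc n} (ℕ.≰⇒> 1+m≰k)) (sym (shift-< (headsAtMost n (suc m)) (ℕ.≰⇒> 1+m≰k)))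
    headEqual (yes 1+m≤k) with ℕ.m≤n⇒∃[o]m+o≡n 1+m≤k
    ... | k′ , refl = trans (unhead m k′ size) (sym (shift-+ (suc m) (headsAtMost n (suc m)) k′))

  module _ (b : PowerSeries) (base : ∀ n k → k + e ≤ suc n → headsAtMost n 0 k ≡ b k) where

    -- Both sides satisfy the same recursion, used by induction on `n` and then `m`; the series `b`
    -- enters as the initial value at `m = 0`.
    headsAtMost-⊛ : ∀ n m k → k + e ≤ suc n → headsAtMost n m k ≡ (boundedPartitions m ⊛ b) k
    headsAtMost-⊛ n       zero    k size = trans (base n k size)
      (sym (trans (⊛-congˡ b boundedPartitions-zero k) (⊛-identityˡ b k)))
    -- With a single letter the first entry is 0 whatever the bound, so `m` may be lowered; the
    -- constant term of `boundedPartitions` is 1 for every bound.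
    headsAtMost-⊛ zero    (suc m) zero    size = trans
      (count-⇔ (headAtMost? (suc m) 0) (headAtMost? m 0)
        (λ {π} (inv≡0 , a , _) → inv≡0 , a , head≤ π) (λ {π} (inv≡0 , a , _) → inv≡0 , a , head≤ π) (permutations 1))
      (headsAtMost-⊛ zero m zero size)
      where
      head≤ : ∀ (π : Permutation′ 1) {m} → toℕ (π ⟨$⟩ʳ zero) ≤ m
      head≤ π with π ⟨$⟩ʳ zero
      ... | zero = z≤n
    headsAtMost-⊛ zero    (suc m) (suc k) (s≤s k+e≤0) = contradiction 0<e (ℕ.≤⇒≯ (ℕ.m+n≤o⇒n≤o k k+e≤0))
    headsAtMost-⊛ (suc n) (suc m) k size = begin
      headsAtMost (suc n) (suc m) k
        ≡⟨ headsAtMost-suc n m k size ⟩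
      headsAtMost (suc n) m k + shift (suc m) (headsAtMost n (suc m)) k
        -- The size condition carries over to `k′`: one letter is lost, but so are `suc m`
        -- inversions.
        ≡⟨ cong₂ _+_ (headsAtMost-⊛ (suc n) m k size)
             (shift-cong (suc m) k λ { k′ refl → headsAtMost-⊛ n (suc m) k′
               (ℕ.m+n≤o⇒n≤o m (ℕ.≤-trans (ℕ.≤-reflexive (sym (ℕ.+-assoc m k′ e))) (s≤s⁻¹ size))) }) ⟩
      (boundedPartitions m ⊛ b) k + shift (suc m) (boundedPartitions (suc m) ⊛ b) k
        ≡⟨ cong ((boundedPartitions m ⊛ b) k +_) (shift-⊛ (suc m) (boundedPartitions (suc m)) b k) ⟨
      (boundedPartitions m ⊛ b) k + (shift (suc m) (boundedPartitions (suc m)) ⊛ b) k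
        ≡⟨ ⊛-distribʳ-+ (boundedPartitions m) (shift (suc m) (boundedPartitions (suc m))) b k ⟨
      ((λ i → boundedPartitions m i + shift (suc m) (boundedPartitions (suc m)) i) ⊛ b) k
        ≡⟨ ⊛-congˡ b (boundedPartitions-suc m) k ⟨
      (boundedPartitions (suc m) ⊛ b) k ∎
      where open ≡-Reasoning

-- The recursion for 132 and for 1324

Avoids132 Avoids1324 : Pred (Permutation′ n) 0ℓ
Avoids132  π = ¬ Has132 (π ⟨$⟩ʳ_)
Avoids1324 π = ¬ Has1324 (π ⟨$⟩ʳ_)

avoids132? : Decidable (Avoids132 {n})
avoids132? π = ¬? (has132? (π ⟨$⟩ʳ_))

avoids1324? : Decidable (Avoids1324 {n})
avoids1324? π = ¬? (has1324? (π ⟨$⟩ʳ_))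

avoids132-resp : ∀ {π ρ : Permutation′ n} → π ≈ₚ ρ → Avoids132 π → Avoids132 ρ
avoids132-resp π≈ρ ¬132 = ¬132 ∘ has132-resp (sym ∘ π≈ρ)

avoids1324-resp : ∀ {π ρ : Permutation′ n} → π ≈ₚ ρ → Avoids1324 π → Avoids1324 ρ
avoids1324-resp π≈ρ ¬1324 = ¬1324 ∘ has1324-resp (sym ∘ π≈ρ)

avoids132-insert : ∀ (j : Fin (suc (suc n))) (ρ : Permutation′ (suc n)) →
                   Avoids132 (insert zero j ρ) ⇔ (Avoids132 ρ × toℕ (ρ ⟨$⟩ʳ zero) ≤ toℕ j)
avoids132-insert j ρ = mk⇔
  (λ ¬132 → ¬132 ∘ has132-insert j ρ , ℕ.≮⇒≥ (¬132 ∘ ascent⇒has132 j ρ))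
  (λ (¬132 , ρ0≤j) → ¬132 ∘ has132-insert⁻¹ j ρ ρ0≤j)

avoids1324-insert : ∀ (j : Fin (suc (suc n))) (ρ : Permutation′ (suc n)) → 0 < toℕ j →
                    inv (insert zero j ρ) + 2 ≤ suc (suc n) →
                    Avoids1324 (insert zero j ρ) ⇔ (Avoids1324 ρ × toℕ (ρ ⟨$⟩ʳ zero) ≤ toℕ j)
avoids1324-insert j ρ 0<j size = mk⇔
  (λ ¬1324 → ¬1324 ∘ has1324-insert j ρ , ℕ.≮⇒≥ λ j<ρ0 →
    let (c , 0<c , c<n , cut) = few-inversions⇒cut (insert zero j ρ) size
    in ¬1324 (ascent∧cut⇒has1324 j ρ 0<j 0<c c<n cut j<ρ0))
  (λ (¬1324 , ρ0≤j) → ¬1324 ∘ has1324-insert⁻¹ j ρ ρ0≤j)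

-- For 1324 the value `e = 2` is what `few-inversions⇒cut` asks for. Deleting a leading 0 turns
-- `k + 2 ≤ suc n` into `k + 1 ≤ n`, which is the size condition for 132 with `e = 1`.
module Avoid132 = FirstEntry Avoids132 avoids132?
  (λ {_} {π} {ρ} → avoids132-resp {π = π} {ρ}) 1 z<s (λ j ρ _ _ → avoids132-insert j ρ)

module Avoid1324 = FirstEntry Avoids1324 avoids1324?
  (λ {_} {π} {ρ} → avoids1324-resp {π = π} {ρ}) 2 z<s avoids1324-insert

-- A leading 0 turns any inversion into a 132, so the identity is the only permutation left.
avoid132-head-0 : ∀ n k → k + 1 ≤ suc n → Avoid132.headsAtMost n 0 k ≡ δ k
avoid132-head-0 n zero    _ = ℕ.≤-antisym
  -- The single permutation of no letters serves as a one-element set to compare with.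
  (count-permutations-≤ (Avoid132.headAtMost? {n} 0 0) true? (λ _ _ → tt) (λ _ → id {0}) (λ _ → tt)
    λ {π} {ρ} (invπ≡0 , _) (invρ≡0 , _) _ i → trans (inv≡0⇒id π invπ≡0 i) (sym (inv≡0⇒id ρ invρ≡0 i)))
  (count-permutations-≤ true? (Avoid132.headAtMost? {n} 0 0) (λ {π} {ρ} → Avoid132.headAtMost-resp 0 0 {π} {ρ}) (λ _ → id)
    (λ _ → inv-id (suc n) , (λ (_ , _ , _ , _ , b<c , _ , c<b) → ℕ.<-asym b<c c<b) , z≤n)
    λ _ _ _ ())
  where
  true? : Decidable {A = Permutation′ 0} (λ _ → ⊤)
  true? _ = yes tt
avoid132-head-0 n (suc k) _ = count-none (Avoid132.headAtMost? 0 (suc k))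
  (λ {π} (inv≡ , ¬132 , π0≤0) → ℕ.0≢1+n (trans (sym (no-inversions π ¬132 π0≤0)) inv≡)) (permutations (suc n))
  where
  no-inversions : ∀ π → Avoids132 π → toℕ (π ⟨$⟩ʳ zero) ≤ 0 → inv π ≡ 0
  no-inversions π ¬132 π0≤0 =
    count-none (isInversion? π) (λ {x} → impossible {x}) (cartesianProduct (allFin (suc n)) (allFin (suc n)))
    where
    impossible : ∀ {x} → ¬ IsInversion π x
    impossible {zero  , j} (_ , π0>πj) = ℕ.<⇒≱ (ℕ.≤-<-trans z≤n π0>πj) π0≤0
    impossible {suc i , j@(suc _)} (i<j , πi>πj) = ¬132 (zero , suc i , j , z<s , i<j , π0<πj , πi>πj)
      where
      π0<πj : π ⟨$⟩ʳ zero Fin.< π ⟨$⟩ʳ j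
      π0<πj = ℕ.≤∧≢⇒< (ℕ.≤-trans π0≤0 z≤n) λ eq → contradiction (injective π (Fin.toℕ-injective eq)) λ ()

-- With initial series `δ` the convolution disappears. The bound `n` restricts neither the first
-- entry among `suc n` letters nor the parts of a partition of `k ≤ n`.
count-avoid132 : ∀ n k → k + 1 ≤ n →
  count (λ (π : Permutation′ n) → inv π ℕ.≟ k ×-dec avoids132? π) (permutations n) ≡ p k
count-avoid132 zero    k k+1≤0 = contradiction (ℕ.m+n≤o⇒n≤o k k+1≤0) λ ()
count-avoid132 (suc n) k k+1≤1+n = begin
  count (λ π → inv π ℕ.≟ k ×-dec avoids132? π) (permutations (suc n))
    ≡⟨ count-⇔ _ (Avoid132.headAtMost? n k) (λ {π} (inv≡k , ¬132) → inv≡k , ¬132 , s≤s⁻¹ (Fin.toℕ<n (π ⟨$⟩ʳ zero)))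
         (λ (inv≡k , ¬132 , _) → inv≡k , ¬132) (permutations (suc n)) ⟩
  Avoid132.headsAtMost n n k
    ≡⟨ Avoid132.headsAtMost-⊛ δ avoid132-head-0 n n k k+1≤1+n ⟩
  (boundedPartitions n ⊛ δ) k
    ≡⟨ ⊛-identityʳ (boundedPartitions n) k ⟩
  boundedPartitions n k
    ≡⟨ p≡boundedPartitions (s≤s⁻¹ (ℕ.≤-trans (ℕ.≤-reflexive (ℕ.+-comm 1 k)) k+1≤1+n)) ⟨
  p k ∎
  where open ≡-Reasoning

-- After a leading 0, avoiding 1324 means that the rest avoids 213. Its reverse-complement is a
-- 132-avoider with as many inversions, counted by `count-avoid132`.
avoid1324-head-0 : ∀ n k → k + 2 ≤ suc n → Avoid1324.headsAtMost n 0 k ≡ p k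
avoid1324-head-0 n k k+2≤1+n = trans (ℕ.≤-antisym
  (count-permutations-≤ (Avoid1324.headAtMost? 0 k) target?
    (λ {π} {ρ} → target-resp {π} {ρ})
    (reverseComplement ∘ remove zero) (λ {π} → to π)
    (λ {π} {ρ} (_ , _ , π0≤0) (_ , _ , ρ0≤0) eq i → trans (sym (insert-remove zero π i))
      (trans (insert-cong {π = remove zero π} {remove zero ρ} (trans (head≡0 π π0≤0) (sym (head≡0 ρ ρ0≤0)))
               (reverseComplement-injective {π = remove zero π} {remove zero ρ} eq) i)
        (insert-remove zero ρ i))))
  (count-permutations-≤ target? (Avoid1324.headAtMost? 0 k)
    (λ {π} {ρ} → Avoid1324.headAtMost-resp 0 k {π} {ρ})
    (insert zero zero ∘ reverseComplement)
    (λ {ρ} (inv≡k , ¬132) →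
        trans (inv-insert zero (reverseComplement ρ)) (trans (inv-reverseComplement ρ) inv≡k)
      , ¬132 ∘ has132-resp (reverseComplement-involutive ρ) ∘ has213⇒has132-reverseComplement (reverseComplement ρ)
          ∘ insert-0-has1324⁻¹ (reverseComplement ρ)
      , z≤n)
    (λ {π} {ρ} _ _ eq → reverseComplement-injective {π = π} {ρ}
      (proj₂ (insert-injective {j = zero} {zero} {reverseComplement π} {reverseComplement ρ} eq)))))
  (count-avoid132 n k (s≤s⁻¹ (ℕ.≤-trans (ℕ.≤-reflexive (sym (ℕ.+-suc k 1))) k+2≤1+n)))
  where
  Target : Pred (Permutation′ n) 0ℓ
  Target π = inv π ≡ k × Avoids132 π

  target? : Decidable Target
  target? π = inv π ℕ.≟ k ×-dec avoids132? π

  target-resp : Target Respects _≈ₚ_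
  target-resp {π} {ρ} π≈ρ (inv≡k , ¬132) =
    trans (sym (inv-cong {π = π} {ρ} π≈ρ)) inv≡k , avoids132-resp {π = π} {ρ} π≈ρ ¬132

  head≡0 : ∀ (π : Permutation′ (suc n)) → toℕ (π ⟨$⟩ʳ zero) ≤ 0 → π ⟨$⟩ʳ zero ≡ zero
  head≡0 π π0≤0 = Fin.toℕ-injective (ℕ.n≤0⇒n≡0 π0≤0)

  to : ∀ π → Avoid1324.HeadAtMost 0 k π → Target (reverseComplement (remove zero π))
  to π (inv≡k , ¬1324 , π0≤0) =
      trans (inv-reverseComplement ρ)
        (trans (cong (λ x → toℕ x + inv ρ) (sym (head≡0 π π0≤0))) (trans (sym (inv-remove π)) inv≡k))
    , ¬1324 ∘ has1324-resp insert-0-remove ∘ insert-0-has1324 ρ ∘ has213-resp (reverseComplement-involutive ρ)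
        ∘ has132⇒has213-reverseComplement (reverseComplement ρ)
    where
    ρ = remove zero π

    insert-0-remove : insert zero zero ρ ≈ₚ π
    insert-0-remove i = trans (insert-cong {π = ρ} {ρ} (sym (head≡0 π π0≤0)) (λ _ → refl) i) (insert-remove zero π i)

-- The counts and the limit sequence

-- One factor `p` counts the nonzero first entries peeled off, again with a vacuous bound `n`; the
-- other is the initial series, from the permutations that start with 0.
av-1324 : ∀ k n → n ≥ k + 2 → av n k (pattern1324 ∷ []) ≡ (p ⊛ p) k
av-1324 k zero    n≥k+2 = contradiction (ℕ.m+n≤o⇒n≤o k n≥k+2) λ ()
av-1324 k (suc n) n≥k+2 = begin
  av (suc n) k (pattern1324 ∷ [])
    ≡⟨ count-⇔ (avoidsWithInversions? k (pattern1324 ∷ [])) (Avoid1324.headAtMost? n k)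
         (λ { {π} (inv≡k , avoids ∷ []) → inv≡k , avoids ∘ has1324⇒contains1324 π , s≤s⁻¹ (Fin.toℕ<n (π ⟨$⟩ʳ zero)) })
         (λ {π} (inv≡k , ¬1324 , _) → inv≡k , ¬1324 ∘ contains1324⇒has1324 π ∷ []) (permutations (suc n)) ⟩
  Avoid1324.headsAtMost n n k
    ≡⟨ Avoid1324.headsAtMost-⊛ p avoid1324-head-0 n n k n≥k+2 ⟩
  (boundedPartitions n ⊛ p) k
    ≡⟨ ∑-cong k {λ i → p i * p (k ∸ i)} {λ i → boundedPartitions n i * p (k ∸ i)}
         (λ {i} i≤k → cong (_* p (k ∸ i)) (p≡boundedPartitions (ℕ.≤-trans i≤k k≤n))) ⟨
  (p ⊛ p) k ∎
  where
  open ≡-Reasoning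
  k≤n : k ≤ n
  k≤n = ℕ.m+n≤o⇒m≤o k (s≤s⁻¹ (ℕ.≤-trans (ℕ.≤-reflexive (sym (ℕ.+-suc k 1))) n≥k+2))

av-1324-2413 : ∀ k n → n ≥ k + 2 → av n k (pattern1324 ∷ pattern2413 ∷ []) ≡ av n k (pattern1324 ∷ [])
av-1324-2413 k n n≥k+2 =
  count-⇔ (avoidsWithInversions? k (pattern1324 ∷ pattern2413 ∷ [])) (avoidsWithInversions? k (pattern1324 ∷ []))
    (λ { (inv≡k , ¬1324 ∷ _) → inv≡k , ¬1324 ∷ [] })
    (λ { {π} (refl , ¬1324 ∷ []) → refl , ¬1324 ∷ avoids2413 π ¬1324 n≥k+2 ∷ [] })
    (permutations n)
  where
  avoids2413 : ∀ (π : Permutation′ n) → Avoids π pattern1324 → n ≥ inv π + 2 → Avoids π pattern2413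
  avoids2413 π ¬1324 n≥inv+2 =
    let (c , 0<c , c<n , cut) = few-inversions⇒cut π n≥inv+2
    in cut⇒avoids2413 π 0<c c<n cut (¬1324 ∘ has1324⇒contains1324 π)

proposition5p12 : (∀ (k n : ℕ) → n ≥ k + 2 →
    av n k (pattern1324 ∷ pattern2413 ∷ []) ≡ av n k (pattern1324 ∷ [])
    × av n k (pattern1324 ∷ []) ≡ ∑[0≤i≤ k ] (λ i → p i * p (k ∸ i)))
    × (∃ λ (L : LimitSequence (pattern1324 ∷ pattern2413 ∷ [])) → limitGF L ≗ P ²)
proposition5p12 =
    (λ k n n≥k+2 → av-1324-2413 k n n≥k+2 , av-1324 k n n≥k+2)
  -- The limit sequence is given as `P ²` itself, stable from `k + 2` on, so the final equality
  -- holds by definition.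
  , (P ² , λ k → k + 2 , λ n n≥k+2 → trans (av-1324-2413 k n n≥k+2) (av-1324 k n n≥k+2))
  , λ _ → refl
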